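{- Let $d$ be a positive integer and let $\mathcal{P}$ be a $d$-dimensional convex lattice polytope with Ehrhart polynomial $L_{\mathcal{P}}(t)=L_0+L_1t+\dots+L_dt^d$ (so $L_0=1$). Let $c_0=(-1)^{d+1}d$ and, for $1\le k\le d$, let $$c_k=\begin{cases}(-1)^{d+1}(2^k-1-d), & k\text{ odd},\\ (-1)^{d}(2^k-1-d), & k\text{ even}.\end{cases}$$ Then $$c_0L_0+c_1L_1+\dots+c_dL_d\geq0.$$
   Context: A lattice polytope is a convex polytope whose vertices lie in $\mathbb{Z}^d\subset\mathbb{R}^d$; $L_{\mathcal{P}}(t)$ is the number of points of $\mathbb{Z}^d$ in the dilate $t\mathcal{P}$, which is a polynomial in $t$ of degree $d$ (the Ehrhart polynomial). -}

module Defs where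

open import Data.Nat as ℕ using (ℕ; zero; suc)
open import Data.Nat.DivMod using (_%_)
open import Data.Integer as ℤ using (ℤ; +_)
open import Data.Rational as ℚ using (ℚ; _/_; 0ℚ; 1ℚ)
open import Data.Vec as V using (Vec; []; _∷_)
open import Data.Vec.Relation.Unary.All using (All)
open import Data.List using (List; length)
open import Data.List.Relation.Unary.Unique.Propositional using (Unique)
open import Data.List.Membership.Propositional using (_∈_)
open import Data.Product using (Σ; ∃; _×_)
open import Function.Bundles using (_⇔_)
open import Relation.Binary.PropositionalEquality using (_≡_)

ℤ→ℚ : ℤ → ℚ
ℤ→ℚ z = z / 1

ℕ→ℚ : ℕ → ℚ
ℕ→ℚ n = (+ n) / 1

toQ : ∀ {d} → Vec ℤ d → Vec ℚ d
toQ = V.map ℤ→ℚ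

zeroV : ∀ {d} → Vec ℚ d
zeroV = V.replicate _ 0ℚ

addV : ∀ {d} → Vec ℚ d → Vec ℚ d → Vec ℚ d
addV = V.zipWith ℚ._+_

subV : ∀ {d} → Vec ℚ d → Vec ℚ d → Vec ℚ d
subV = V.zipWith ℚ._-_

scaleV : ∀ {d} → ℚ → Vec ℚ d → Vec ℚ d
scaleV a = V.map (a ℚ.*_)

lincomb : ∀ {n d} → Vec ℚ n → Vec (Vec ℚ d) n → Vec ℚ d
lincomb [] [] = zeroV
lincomb (a ∷ as) (w ∷ ws) = addV (scaleV a w) (lincomb as ws)

sumQ : ∀ {n} → Vec ℚ n → ℚ
sumQ = V.foldr _ ℚ._+_ 0ℚ

-- The polytope P = conv(V) for a nonempty finite family V of lattice points
-- (so P is a lattice polytope).  x ∈ t·P  iff  x is a convex combination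
-- of the points t·v_i.
InDilate : ∀ {n d} → Vec (Vec ℤ d) (suc n) → ℕ → Vec ℤ d → Set
InDilate {n} {d} vs t x =
  Σ (Vec ℚ (suc n)) λ λs →
    All (0ℚ ℚ.≤_) λs × sumQ λs ≡ 1ℚ
      × lincomb λs (V.map (λ v → scaleV (ℕ→ℚ t) (toQ v)) vs) ≡ toQ x

-- conv(V) is d-dimensional: its affine hull is all of ℚ^d, i.e. the
-- differences v_i - v_0 span ℚ^d.
FullDim : ∀ {n d} → Vec (Vec ℤ d) (suc n) → Set
FullDim {n} {d} (v₀ ∷ vs) =
  (y : Vec ℚ d) → Σ (Vec ℚ (suc n)) λ μ →
    lincomb μ (V.map (λ v → subV (toQ v) (toQ v₀)) (v₀ ∷ vs)) ≡ y

evalPoly : ∀ {m} → Vec ℚ m → ℚ → ℚ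
evalPoly [] t = 0ℚ
evalPoly (a ∷ as) t = a ℚ.+ t ℚ.* evalPoly as t

IsEhrhartPoly : ∀ {n d} → Vec (Vec ℤ d) (suc n) → Vec ℚ (suc d) → Set
IsEhrhartPoly {n} {d} vs L =
  (t : ℕ) → 1 ℕ.≤ t →
    Σ (List (Vec ℤ d)) λ xs →
      Unique xs × ((x : Vec ℤ d) → (x ∈ xs) ⇔ InDilate vs t x)
        × ℕ→ℚ (length xs) ≡ evalPoly L (ℕ→ℚ t)

sgn : ℕ → ℤ
sgn zero = + 1
sgn (suc m) = ℤ.- sgn m

c : (d k : ℕ) → ℤ
c d zero = sgn (suc d) ℤ.* (+ d)
c d (suc j) with (suc j) % 2
... | zero  = sgn d ℤ.* ((+ (2 ℕ.^ suc j)) ℤ.- (+ 1) ℤ.- (+ d))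
... | suc _ = sgn (suc d) ℤ.* ((+ (2 ℕ.^ suc j)) ℤ.- (+ 1) ℤ.- (+ d))

weightedSum : (d : ℕ) → Vec ℚ (suc d) → ℚ
weightedSum d L = go 0 L
  where
  go : ∀ {m} → ℕ → Vec ℚ m → ℚ
  go k [] = 0ℚ
  go k (a ∷ as) = ℤ→ℚ (c d k) ℚ.* a ℚ.+ go (suc k) as

{-# OPTIONS --safe #-}

-- With D the dimension of P, the weighted sum is (-1)^D (L(-2) - (D+1) L(-1)), which is the
-- entry h*_{D-1} of the h*-vector: it is the (D+1)-st difference of the counting function of the
-- dilates (extended by 1 at factor 0 and by 0 below) that ends at factor D-1.  To see that it is
-- nonnegative, triangulate the cone over P without new vertices and perturb all lattice points by
-- one small generic vector ξ of the cone, so that each of them lies in the interior of exactly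
-- one maximal simplicial cone.  On a single such cone the (D+1)-st difference counts the lattice
-- points with all coordinates in (0 , 1] (after the perturbation) of a given height, hence is
-- nonnegative; since the coordinates add up to the height plus that of ξ, no such point has
-- height D+1.  Vanishing there gives L(0) = 1, which is not part of the hypotheses.
-- The triangulation is never constructed: the simplex containing a point is the support of its
-- lexicographically minimal nonnegative representation by the generators, whose existence is
-- Fourier–Motzkin elimination.
module Submission where

open import Defs
open import Data.Nat using (ℕ; suc)
open import Data.Integer using (ℤ)
open import Data.Rational using (ℚ; 0ℚ; _≤_)
open import Data.Vec using (Vec)

open import Algebra.Bundles using (CommutativeRing)
open import Data.Bool using (Bool; true; false; if_then_else_)
import Data.Bool.Properties as Bool
open import Data.Empty using (⊥; ⊥-elim)
open import Data.Fin as Fin using (Fin; zero; suc)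
import Data.Fin.Properties as Fin
open import Data.Integer as ℤ using (-[1+_])
import Data.Integer.Properties as ℤ
open import Data.List as List
  using (List; []; _∷_; _++_; _ʳ++_; map; filter; length; allFin; concatMap; cartesianProductWith)
open import Data.List.Membership.Propositional using (_∈_; lose)
open import Data.List.Membership.Propositional.Properties
  using (∈-++⁻; ∈-++⁺ˡ; ∈-++⁺ʳ; ∈-map⁻; ∈-map⁺; ∈-allFin; ∈-filter⁻; ∈-filter⁺
        ; ∈-cartesianProductWith⁻; ∈-cartesianProductWith⁺; ∈-concatMap⁺)
open import Data.List.Membership.Propositional.Properties.WithK using (unique∧set⇒bag)
open import Data.List.Properties using (length-map; filter-all; filter-none)
open import Data.List.Relation.Binary.BagAndSetEquality using (∼bag⇒↭)
open import Data.List.Relation.Binary.Permutation.Propositional.Properties using (↭-length)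
open import Data.List.Relation.Unary.All as All using (All; []; _∷_; all?)
open import Data.List.Relation.Unary.Any using (here; there)
open import Data.List.Relation.Unary.Any.Properties using (reverseAcc⁺)
open import Data.List.Relation.Unary.Unique.Propositional using (Unique; []; _∷_)
import Data.List.Relation.Unary.Unique.Propositional.Properties as Unique
open import Data.Nat as ℕ using (zero)
open import Data.Nat.DivMod using (_%_)
import Data.Nat.Properties as ℕ
open import Data.Product using (Σ; ∃; _×_; _,_; proj₁; proj₂)
open import Data.Rational as ℚ using (1ℚ; ½; _<_; _≤?_; _<?_; _+_; _*_; _-_; -_; _⊓_)
open import Data.Rational.Properties as ℚ
  using (≤-refl; ≤-trans; ≤-antisym; <⇒≤; <-cmp; <-irrefl; <-≤-trans; ≤-<-trans; <-trans; _≟_)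
open import Data.Rational.Solver using (module +-*-Solver)
open import Data.Rational.Unnormalised as ℚᵘ using (mkℚᵘ; *≡*)
import Data.Rational.Unnormalised.Properties as ℚᵘ
open import Data.Sum as Sum using (_⊎_; inj₁; inj₂)
open import Data.Vec as Vec using ([]; _∷_; head; tail; lookup; tabulate; replicate; zipWith)
import Data.Vec.Properties as Vec
open import Data.Vec.Functional using () renaming (_∷_ to _◂_)
open import Data.Vec.Relation.Unary.All.Properties using (tabulate⁺; lookup⁺)
open import Function using (_∘_; id; mk⇔; Equivalence)
open import Relation.Binary.Definitions using (tri<; tri≈; tri>)
open import Relation.Binary.PropositionalEquality
open import Relation.Nullary using (¬_; Dec; yes; no; does; contradiction; ¬?; _×-dec_)
open import Relation.Nullary.Decidable using (decidable-stable)
open import Relation.Unary using (Decidable)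

open import Algebra.Properties.Semiring.Sum (CommutativeRing.semiring ℚ.+-*-commutativeRing)
  using (sum; sum-cong-≗; sum-replicate-zero; ∑-distrib-+; ∑-comm; *-distribˡ-sum)
open +-*-Solver using (solve; _:=_; _:+_; _:*_; _:-_; :-_; con)

-- The weights come from two evaluations: (-1)^k 2^k is (-2)^k, so 2^k collects L(-2) and the
-- remaining -(1 + d) collects L(-1). Both values enter as the error of L as a counting function:
-- its (D+1)-st difference is zero, so the count and the error have equal differences, and the error
-- lives at factors at most 0 only. Closed simplicial cones overlap along faces, and
-- inclusion-exclusion would bring in signs; this is what the perturbation avoids. It does not
-- change which lattice points are counted, because the forms that cut out the cones are integral: a
-- change of size below 1 cannot lift a negative integer to a nonnegative number. Fourier-Motzkin
-- elimination does three jobs at once: it yields those integral forms, decides membership in the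
-- cone, and finds the minimal representation. Whether a representation is minimal depends on its
-- support alone, so a cell can be handled as a mere subset of the generators.

-- Rational arithmetic: signs and inverses.

0≤+ : ∀ {p q} → 0ℚ ≤ p → 0ℚ ≤ q → 0ℚ ≤ p + q
0≤+ = ℚ.+-mono-≤

0<+ : ∀ {p q} → 0ℚ < p → 0ℚ ≤ q → 0ℚ < p + q
0<+ = ℚ.+-mono-<-≤

0≤* : ∀ {p q} → 0ℚ ≤ p → 0ℚ ≤ q → 0ℚ ≤ p * q
0≤* {p} {q} p≥0 q≥0 = ℚ.nonNegative⁻¹ (p * q)
  ⦃ ℚ.nonNeg*nonNeg⇒nonNeg p ⦃ ℚ.nonNegative p≥0 ⦄ q ⦃ ℚ.nonNegative q≥0 ⦄ ⦄

0<* : ∀ {p q} → 0ℚ < p → 0ℚ < q → 0ℚ < p * q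
0<* {p} {q} p>0 q>0 = ℚ.positive⁻¹ (p * q)
  ⦃ ℚ.pos*pos⇒pos p ⦃ ℚ.positive p>0 ⦄ q ⦃ ℚ.positive q>0 ⦄ ⦄

≤⇒0≤- : ∀ {p q} → p ≤ q → 0ℚ ≤ q - p
≤⇒0≤- {p} {q} p≤q = subst (_≤ q - p) (ℚ.+-inverseʳ p) (ℚ.+-monoˡ-≤ (- p) p≤q)

<⇒0<- : ∀ {p q} → p < q → 0ℚ < q - p
<⇒0<- {p} {q} p<q = subst (_< q - p) (ℚ.+-inverseʳ p) (ℚ.+-monoˡ-< (- p) p<q)

p+q-p : ∀ p q → p + (q - p) ≡ q
p+q-p = solve 2 (λ p q → p :+ (q :- p) := q) refl

0≤-⇒≤ : ∀ {p q} → 0ℚ ≤ q - p → p ≤ q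
0≤-⇒≤ {p} {q} h = subst₂ _≤_ (ℚ.+-identityʳ p) (p+q-p p q) (ℚ.+-monoʳ-≤ p h)

0<-⇒< : ∀ {p q} → 0ℚ < q - p → p < q
0<-⇒< {p} {q} h = subst₂ _<_ (ℚ.+-identityʳ p) (p+q-p p q) (ℚ.+-monoʳ-< p h)

-⇒≡ : ∀ {p q} → p - q ≡ 0ℚ → p ≡ q
-⇒≡ {p} {q} h = trans (sym (p+q-p q p)) (trans (cong (λ z → q + z) h) (ℚ.+-identityʳ q))

neg-pos : ∀ {p} → p < 0ℚ → 0ℚ < - p
neg-pos = ℚ.neg-antimono-<

neg-nonNeg : ∀ {p} → p ≤ 0ℚ → 0ℚ ≤ - p
neg-nonNeg = ℚ.neg-antimono-≤

inverse : ∀ {p} → 0ℚ < p → Σ ℚ λ r → 0ℚ < r × r * p ≡ 1ℚ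
inverse {p} p>0 = (ℚ.1/ p) , ℚ.positive⁻¹ (ℚ.1/ p) ⦃ ℚ.1/pos⇒pos p ⦄ , ℚ.*-inverseˡ p
  where instance
    pos = ℚ.positive p>0
    nz = ℚ.pos⇒nonZero p

0≤*⁻¹ : ∀ {p q} → 0ℚ < p → 0ℚ ≤ p * q → 0ℚ ≤ q
0≤*⁻¹ {p} {q} p>0 h = let (r , r>0 , rp) = inverse p>0 in
  subst (0ℚ ≤_) (trans (sym (ℚ.*-assoc r p q)) (trans (cong (_* q) rp) (ℚ.*-identityˡ q)))
    (0≤* (<⇒≤ r>0) h)

p*q≡0⇒q≡0 : ∀ {p q} → 0ℚ < p → p * q ≡ 0ℚ → q ≡ 0ℚ
p*q≡0⇒q≡0 {p} {q} p>0 h = let (r , r>0 , rp) = inverse p>0 in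
  trans (sym (trans (sym (ℚ.*-assoc r p q)) (trans (cong (_* q) rp) (ℚ.*-identityˡ q))))
    (trans (cong (r *_) h) (ℚ.*-zeroʳ r))

0<1 : 0ℚ < 1ℚ
0<1 = ℚ.positive⁻¹ 1ℚ

-- Finite sums and the Kronecker delta.

opaque
  ∑ : ∀ {n} → (Fin n → ℚ) → ℚ
  ∑ = sum

  ∑-nil : (f : Fin 0 → ℚ) → ∑ f ≡ 0ℚ
  ∑-nil _ = refl

  ∑-cons : ∀ {n} (f : Fin (suc n) → ℚ) → ∑ f ≡ f zero + ∑ (f ∘ suc)
  ∑-cons _ = refl

  ∑-cong : ∀ {n} {f g : Fin n → ℚ} → (∀ i → f i ≡ g i) → ∑ f ≡ ∑ g
  ∑-cong = sum-cong-≗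

  ∑-+ : ∀ {n} (f g : Fin n → ℚ) → ∑ (λ i → f i + g i) ≡ ∑ f + ∑ g
  ∑-+ = ∑-distrib-+

  ∑-*ˡ : ∀ {n} r (f : Fin n → ℚ) → ∑ (λ i → r * f i) ≡ r * ∑ f
  ∑-*ˡ r f = sym (*-distribˡ-sum r f)

  ∑-swap : ∀ {n m} (f : Fin n → Fin m → ℚ) → ∑ (λ i → ∑ (f i)) ≡ ∑ (λ j → ∑ (λ i → f i j))
  ∑-swap = ∑-comm

  ∑-zero : ∀ {n} {f : Fin n → ℚ} → (∀ i → f i ≡ 0ℚ) → ∑ f ≡ 0ℚ
  ∑-zero {n} h = trans (sum-cong-≗ h) (sum-replicate-zero n)

∑-nonNeg : ∀ {n} {f : Fin n → ℚ} → (∀ i → 0ℚ ≤ f i) → 0ℚ ≤ ∑ f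
∑-nonNeg {zero} {f} _ = ℚ.≤-reflexive (sym (∑-nil f))
∑-nonNeg {suc n} {f} h = subst (0ℚ ≤_) (sym (∑-cons f)) (0≤+ (h zero) (∑-nonNeg (h ∘ suc)))

∑≡0⇒≡0 : ∀ {n} {f : Fin n → ℚ} → (∀ i → 0ℚ ≤ f i) → ∑ f ≡ 0ℚ → ∀ i → f i ≡ 0ℚ
∑≡0⇒≡0 {suc n} {f} f≥0 eq = λ { zero → f₀≡0 ; (suc i) → ∑≡0⇒≡0 (f≥0 ∘ suc) rest i }
  where
  tl = ∑ (f ∘ suc)
  eq′ : f zero + tl ≡ 0ℚ
  eq′ = trans (sym (∑-cons f)) eq
  f₀≡0 : f zero ≡ 0ℚ
  f₀≡0 = ≤-antisym
    (subst₂ _≤_ (ℚ.+-identityʳ (f zero)) eq′ (ℚ.+-monoʳ-≤ (f zero) (∑-nonNeg (f≥0 ∘ suc))))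
    (f≥0 zero)
  rest : tl ≡ 0ℚ
  rest = trans (sym (ℚ.+-identityˡ tl)) (trans (cong (_+ tl) (sym f₀≡0)) eq′)

δ : ∀ {n} → Fin n → Fin n → ℚ
δ zero zero = 1ℚ
δ zero (suc _) = 0ℚ
δ (suc _) zero = 0ℚ
δ (suc i) (suc j) = δ i j

∑-δ : ∀ {n} (i : Fin n) (f : Fin n → ℚ) → ∑ (λ j → δ i j * f j) ≡ f i
∑-δ zero f = trans (∑-cons (λ j → δ zero j * f j))
  (trans (cong₂ _+_ (ℚ.*-identityˡ (f zero)) (∑-zero (λ j → ℚ.*-zeroˡ (f (suc j)))))
    (ℚ.+-identityʳ (f zero)))
∑-δ (suc i) f = trans (∑-cons (λ j → δ (suc i) j * f j))
  (trans (cong₂ _+_ (ℚ.*-zeroˡ (f zero)) (∑-δ i (f ∘ suc))) (ℚ.+-identityˡ _))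

δ-refl : ∀ {n} (i : Fin n) → δ i i ≡ 1ℚ
δ-refl zero = refl
δ-refl (suc i) = δ-refl i

δ-≢ : ∀ {n} {i j : Fin n} → i ≢ j → δ i j ≡ 0ℚ
δ-≢ {i = zero} {zero} h = contradiction refl h
δ-≢ {i = zero} {suc j} h = refl
δ-≢ {i = suc i} {zero} h = refl
δ-≢ {i = suc i} {suc j} h = δ-≢ (h ∘ cong suc)

-- Dot products.

infix 8 _∙_
opaque
  _∙_ : ∀ {m} → (Fin m → ℚ) → (Fin m → ℚ) → ℚ
  a ∙ y = ∑ (λ i → a i * y i)

  ∙-def : ∀ {m} (a y : Fin m → ℚ) → a ∙ y ≡ ∑ (λ i → a i * y i)
  ∙-def a y = refl

  ∙-cong : ∀ {m} {a b y z : Fin m → ℚ} → (∀ i → a i ≡ b i) → (∀ i → y i ≡ z i) → a ∙ y ≡ b ∙ z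
  ∙-cong h h′ = ∑-cong (λ i → cong₂ _*_ (h i) (h′ i))

  ∙-+ : ∀ {m} (a y z : Fin m → ℚ) → a ∙ (λ i → y i + z i) ≡ a ∙ y + a ∙ z
  ∙-+ a y z = trans (∑-cong (λ i → ℚ.*-distribˡ-+ (a i) (y i) (z i)))
    (∑-+ (λ i → a i * y i) (λ i → a i * z i))

  ∙-* : ∀ {m} (a y : Fin m → ℚ) r → a ∙ (λ i → r * y i) ≡ r * (a ∙ y)
  ∙-* a y r = trans
    (∑-cong {g = λ i → r * (a i * y i)}
      (λ i → solve 3 (λ a r y → a :* (r :* y) := r :* (a :* y)) refl (a i) r (y i)))
    (∑-*ˡ r (λ i → a i * y i))

  ∙-comm : ∀ {m} (a y : Fin m → ℚ) → a ∙ y ≡ y ∙ a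
  ∙-comm a y = ∑-cong (λ i → ℚ.*-comm (a i) (y i))

  ∙-cons : ∀ {m} (a y : Fin (suc m) → ℚ) → a ∙ y ≡ a zero * y zero + (a ∘ suc) ∙ (y ∘ suc)
  ∙-cons a y = ∑-cons (λ i → a i * y i)

  ∙-nil : (a y : Fin 0 → ℚ) → a ∙ y ≡ 0ℚ
  ∙-nil a y = ∑-nil (λ i → a i * y i)

  ∙-zero : ∀ {m} (a : Fin m → ℚ) {y : Fin m → ℚ} → (∀ i → y i ≡ 0ℚ) → a ∙ y ≡ 0ℚ
  ∙-zero a h = ∑-zero (λ i → trans (cong (a i *_) (h i)) (ℚ.*-zeroʳ (a i)))

  ∙-swap : ∀ {n m} (a : Fin m → ℚ) (l : Fin n → ℚ) (w : Fin n → Fin m → ℚ)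
    → a ∙ (λ i → l ∙ (λ j → w j i)) ≡ l ∙ (λ j → a ∙ w j)
  ∙-swap a l w = begin
    ∑ (λ i → a i * ∑ (λ j → l j * w j i))   ≡⟨ ∑-cong (λ i → sym (∑-*ˡ (a i) (λ j → l j * w j i))) ⟩
    ∑ (λ i → ∑ (λ j → a i * (l j * w j i))) ≡⟨ ∑-swap (λ i j → a i * (l j * w j i)) ⟩
    ∑ (λ j → ∑ (λ i → a i * (l j * w j i))) ≡⟨ ∑-cong (λ j → ∙-* a (w j) (l j)) ⟩
    ∑ (λ j → l j * a ∙ w j) ∎
    where open ≡-Reasoning

∙-congʳ : ∀ {m} (a : Fin m → ℚ) {y z : Fin m → ℚ} → (∀ i → y i ≡ z i) → a ∙ y ≡ a ∙ z
∙-congʳ a = ∙-cong (λ _ → refl)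

∙-congˡ : ∀ {m} {a b : Fin m → ℚ} (y : Fin m → ℚ) → (∀ i → a i ≡ b i) → a ∙ y ≡ b ∙ y
∙-congˡ y h = ∙-cong h (λ _ → refl)

∙-zeroˡ : ∀ {m} {a : Fin m → ℚ} (y : Fin m → ℚ) → (∀ i → a i ≡ 0ℚ) → a ∙ y ≡ 0ℚ
∙-zeroˡ {a = a} y h = trans (∙-comm a y) (∙-zero y h)

∙-+ˡ : ∀ {m} (a b y : Fin m → ℚ) → (λ i → a i + b i) ∙ y ≡ a ∙ y + b ∙ y
∙-+ˡ a b y = trans (∙-comm (λ i → a i + b i) y)
  (trans (∙-+ y a b) (cong₂ _+_ (∙-comm y a) (∙-comm y b)))

∙-*ˡ : ∀ {m} (a y : Fin m → ℚ) r → (λ i → r * a i) ∙ y ≡ r * (a ∙ y)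
∙-*ˡ a y r = trans (∙-comm (λ i → r * a i) y) (trans (∙-* y a r) (cong (r *_) (∙-comm y a)))

∙-δˡ : ∀ {m} (i : Fin m) (y : Fin m → ℚ) → δ i ∙ y ≡ y i
∙-δˡ i y = trans (∙-def (δ i) y) (∑-δ i y)

∙-nonNeg : ∀ {m} {a y : Fin m → ℚ} → (∀ i → 0ℚ ≤ a i) → (∀ i → 0ℚ ≤ y i) → 0ℚ ≤ a ∙ y
∙-nonNeg {a = a} {y} ha hy = subst (0ℚ ≤_) (sym (∙-def a y)) (∑-nonNeg (λ i → 0≤* (ha i) (hy i)))

-- Integers among the rationals.

Integral : ℚ → Set
Integral q = Σ ℤ λ z → q ≡ ℤ→ℚ z

/1-+ : ∀ x y → ℤ→ℚ x + ℤ→ℚ y ≡ ℤ→ℚ (x ℤ.+ y)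
/1-+ x y = ℚ.toℚᵘ-injective (ℚᵘ.≃-trans (ℚ.toℚᵘ-homo-+ (ℤ→ℚ x) (ℤ→ℚ y))
  (ℚᵘ.≃-trans (ℚᵘ.+-cong (ℚ.toℚᵘ-fromℚᵘ (mkℚᵘ x 0)) (ℚ.toℚᵘ-fromℚᵘ (mkℚᵘ y 0)))
  (ℚᵘ.≃-trans (*≡* (cong (λ z → z ℤ.* ℤ.+ 1) (cong₂ ℤ._+_ (ℤ.*-identityʳ x) (ℤ.*-identityʳ y))))
    (ℚᵘ.≃-sym (ℚ.toℚᵘ-fromℚᵘ (mkℚᵘ (x ℤ.+ y) 0))))))

/1-* : ∀ x y → ℤ→ℚ x * ℤ→ℚ y ≡ ℤ→ℚ (x ℤ.* y)
/1-* x y = ℚ.toℚᵘ-injective (ℚᵘ.≃-trans (ℚ.toℚᵘ-homo-* (ℤ→ℚ x) (ℤ→ℚ y))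
  (ℚᵘ.≃-trans (ℚᵘ.*-cong (ℚ.toℚᵘ-fromℚᵘ (mkℚᵘ x 0)) (ℚ.toℚᵘ-fromℚᵘ (mkℚᵘ y 0)))
    (ℚᵘ.≃-sym (ℚ.toℚᵘ-fromℚᵘ (mkℚᵘ (x ℤ.* y) 0)))))

/1-neg : ∀ x → - ℤ→ℚ x ≡ ℤ→ℚ (ℤ.- x)
/1-neg (ℤ.+ zero) = refl
/1-neg (ℤ.+ suc n) = refl
/1-neg -[1+ n ] = solve 1 (λ p → :- (:- p) := p) refl (ℤ→ℚ (ℤ.+ suc n))

/1-mono-≤ : ∀ {x y} → x ℤ.≤ y → ℤ→ℚ x ≤ ℤ→ℚ y
/1-mono-≤ {x} {y} h = ℚ.toℚᵘ-cancel-≤ (ℚᵘ.≤-respˡ-≃ (ℚᵘ.≃-sym (ℚ.toℚᵘ-fromℚᵘ (mkℚᵘ x 0)))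
  (ℚᵘ.≤-respʳ-≃ (ℚᵘ.≃-sym (ℚ.toℚᵘ-fromℚᵘ (mkℚᵘ y 0)))
    (ℚᵘ.*≤* (ℤ.*-monoʳ-≤-nonNeg (ℤ.+ 1) h))))

integral-+ : ∀ {p q} → Integral p → Integral q → Integral (p + q)
integral-+ (x , refl) (y , refl) = x ℤ.+ y , /1-+ x y

integral-* : ∀ {p q} → Integral p → Integral q → Integral (p * q)
integral-* (x , refl) (y , refl) = x ℤ.* y , /1-* x y

integral-neg : ∀ {p} → Integral p → Integral (- p)
integral-neg (x , refl) = ℤ.- x , /1-neg x

integral-∙ : ∀ {m} {a y : Fin m → ℚ} → (∀ i → Integral (a i)) → (∀ i → Integral (y i)) → Integral (a ∙ y)
integral-∙ {zero} {a} {y} _ _ = ℤ.+ 0 , ∙-nil a y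
integral-∙ {suc m} {a} {y} ha hy = subst Integral (sym (∙-cons a y))
  (integral-+ (integral-* (ha zero) (hy zero)) (integral-∙ (ha ∘ suc) (hy ∘ suc)))

integral-cases : ∀ {p} → Integral p → p ≤ - 1ℚ ⊎ p ≡ 0ℚ ⊎ 1ℚ ≤ p
integral-cases (ℤ.+ zero , refl) = inj₂ (inj₁ refl)
integral-cases (ℤ.+ suc n , refl) = inj₂ (inj₂ (/1-mono-≤ {ℤ.+ 1} {ℤ.+ suc n} (ℤ.+≤+ (ℕ.s≤s ℕ.z≤n))))
integral-cases (-[1+ n ] , refl) = inj₁ (/1-mono-≤ { -[1+ n ]} { -[1+ 0 ]} (ℤ.-≤- ℕ.z≤n))

0<*⁻¹ : ∀ {p q} → 0ℚ < p → 0ℚ < p * q → 0ℚ < q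
0<*⁻¹ {p} {q} p>0 h = let (r , r>0 , rp) = inverse p>0 in
  subst (0ℚ <_) (trans (sym (ℚ.*-assoc r p q)) (trans (cong (_* q) rp) (ℚ.*-identityˡ q)))
    (0<* r>0 h)

-- Conditions on small positive parameters; lexicographic signs.

Small : (ℚ → Set) → Set
Small P = Σ ℚ λ θ₀ → 0ℚ < θ₀ × (∀ θ → 0ℚ < θ → θ ≤ θ₀ → P θ)

small-witness : ∀ {P} → Small P → Σ ℚ λ θ → 0ℚ < θ × P θ
small-witness (θ₀ , θ₀>0 , h) = θ₀ , θ₀>0 , h θ₀ θ₀>0 ≤-refl

small-always : ∀ {P : ℚ → Set} → (∀ θ → 0ℚ < θ → P θ) → Small P
small-always h = 1ℚ , 0<1 , λ θ θ>0 _ → h θ θ>0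

-- This is why `Small` asks for every θ up to a bound and not for a single one: the smaller of two
-- bounds serves both conditions.
small-× : ∀ {P Q : ℚ → Set} → Small P → Small Q → Small (λ θ → P θ × Q θ)
small-× (p , p>0 , hp) (q , q>0 , hq) = p ⊓ q , ⊓>0 , λ θ θ>0 θ≤ →
  hp θ θ>0 (≤-trans θ≤ (ℚ.p⊓q≤p p q)) , hq θ θ>0 (≤-trans θ≤ (ℚ.p⊓q≤q p q))
  where
  ⊓>0 : 0ℚ < p ⊓ q
  ⊓>0 with ℚ.≤-total p q
  ... | inj₁ p≤q = subst (0ℚ <_) (sym (ℚ.p≤q⇒p⊓q≡p p≤q)) p>0
  ... | inj₂ q≤p = subst (0ℚ <_) (sym (ℚ.p≥q⇒p⊓q≡q q≤p)) q>0

small-∀ : ∀ {n} {P : Fin n → ℚ → Set} → (∀ i → Small (P i)) → Small (λ θ → ∀ i → P i θ)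
small-∀ {zero} h = small-always λ _ _ ()
small-∀ {suc n} h with small-× (h zero) (small-∀ (h ∘ suc))
... | θ₀ , θ₀>0 , k = θ₀ , θ₀>0 , λ θ θ>0 θ≤ →
  λ { zero → proj₁ (k θ θ>0 θ≤) ; (suc i) → proj₂ (k θ θ>0 θ≤) i }

small-∈ : ∀ {A : Set} {P : A → ℚ → Set} (xs : List A) → (∀ {x} → x ∈ xs → Small (P x))
  → Small (λ θ → ∀ {x} → x ∈ xs → P x θ)
small-∈ [] h = small-always λ _ _ ()
small-∈ (x ∷ xs) h with small-× (h (here refl)) (small-∈ xs (h ∘ there))
... | θ₀ , θ₀>0 , k = θ₀ , θ₀>0 , λ θ θ>0 θ≤ →
  λ { (here refl) → proj₁ (k θ θ>0 θ≤) ; (there x∈) → proj₂ (k θ θ>0 θ≤) x∈ }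

nonPos-* : ∀ {θ m} → 0ℚ < θ → m ≤ 0ℚ → θ * m ≤ 0ℚ
nonPos-* {θ} {m} θ>0 m≤0 = 0≤-⇒≤ (subst (0ℚ ≤_)
  (solve 2 (λ θ m → θ :* (:- m) := con 0ℚ :- θ :* m) refl θ m) (0≤* (<⇒≤ θ>0) (neg-nonNeg m≤0)))

small-< : ∀ {l} m → 0ℚ < l → Small (λ θ → θ * m < l)
small-< {l} m l>0 with 0ℚ <? m
... | no m≯0 = small-always λ θ θ>0 → ≤-<-trans (nonPos-* θ>0 (ℚ.≮⇒≥ m≯0)) l>0
-- Half of l / m, since at l / m itself the inequality would not be strict.
... | yes m>0 = ½ * (r * l) , 0<* ½>0 (0<* r>0 l>0) , λ θ θ>0 θ≤ → 0<-⇒< (subst (0ℚ <_)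
    (trans (solve 5 (λ h r l m θ → h :* l :+ (h :* (r :* l) :- θ) :* m
                                 := h :* l :+ h :* ((r :* m) :* l) :- θ :* m) refl ½ r l m θ)
      (trans (cong (λ z → ½ * l + ½ * (z * l) - θ * m) rm)
        (solve 3 (λ l m θ → con ½ :* l :+ con ½ :* (con 1ℚ :* l) :- θ :* m := l :- θ :* m)
          refl l m θ)))
    (0<+ (0<* ½>0 l>0) (0≤* (≤⇒0≤- θ≤) (<⇒≤ m>0))))
  where
  ½>0 = ℚ.positive⁻¹ ½
  r = proj₁ (inverse m>0)
  r>0 = proj₁ (proj₂ (inverse m>0))
  rm = proj₂ (proj₂ (inverse m>0))

-- The ratio test of linear programming: l is a coefficient, θ m the amount taken from it, and a
-- coefficient that decreases has room to do so.
small-≤ : ∀ {l} m → 0ℚ ≤ l → (0ℚ < m → 0ℚ < l) → Small (λ θ → θ * m ≤ l)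
small-≤ {l} m l≥0 h with 0ℚ <? m
... | no m≯0 = small-always λ θ θ>0 → ≤-trans (nonPos-* θ>0 (ℚ.≮⇒≥ m≯0)) l≥0
... | yes m>0 with small-< m (h m>0)
...   | θ₀ , θ₀>0 , k = θ₀ , θ₀>0 , λ θ θ>0 θ≤ → <⇒≤ (k θ θ>0 θ≤)

LexPos : ∀ {n} → (Fin n → ℚ) → Set
LexPos {zero} f = ⊥
LexPos {suc n} f = 0ℚ < f zero ⊎ (f zero ≡ 0ℚ × LexPos (f ∘ suc))

lex-cmp : ∀ {n} (f : Fin n → ℚ) → LexPos f ⊎ LexPos (λ j → - f j) ⊎ (∀ j → f j ≡ 0ℚ)
lex-cmp {zero} f = inj₂ (inj₂ λ ())
lex-cmp {suc n} f with <-cmp (f zero) 0ℚ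
... | tri< f<0 _ _ = inj₂ (inj₁ (inj₁ (neg-pos f<0)))
... | tri> _ _ f>0 = inj₁ (inj₁ f>0)
... | tri≈ _ f≡0 _ with lex-cmp (f ∘ suc)
...   | inj₁ h = inj₁ (inj₂ (f≡0 , h))
...   | inj₂ (inj₁ h) = inj₂ (inj₁ (inj₂ (cong (-_) f≡0 , h)))
...   | inj₂ (inj₂ h) = inj₂ (inj₂ λ { zero → f≡0 ; (suc j) → h j })

lex-scale : ∀ {n} {f g : Fin n → ℚ} {θ} → 0ℚ < θ → (∀ j → g j ≡ θ * f j) → LexPos f → LexPos g
lex-scale {suc n} θ>0 eq (inj₁ h) = inj₁ (subst (0ℚ <_) (sym (eq zero)) (0<* θ>0 h))
lex-scale {suc n} {θ = θ} θ>0 eq (inj₂ (h , k)) =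
  inj₂ (trans (eq zero) (trans (cong (θ *_) h) (ℚ.*-zeroʳ θ)) , lex-scale θ>0 (eq ∘ suc) k)

-- Cones, their inequalities, and lexicographically minimal representations.

comb : ∀ {n m} → (Fin n → ℚ) → (Fin n → Fin m → ℚ) → Fin m → ℚ
comb l w i = l ∙ (λ j → w j i)

Represents : ∀ {n m} → (Fin n → Fin m → ℚ) → (Fin m → ℚ) → (Fin n → ℚ) → Set
Represents w y l = (∀ j → 0ℚ ≤ l j) × (∀ i → y i ≡ comb l w i)

Cone : ∀ {n m} → (Fin n → Fin m → ℚ) → (Fin m → ℚ) → Set
Cone w y = ∃ (Represents w y)

LexMin : ∀ {n m} → (Fin n → Fin m → ℚ) → (Fin m → ℚ) → (Fin n → ℚ) → Set
LexMin w y l = Represents w y l × (∀ k → Represents w y k → ¬ LexPos (λ j → l j - k j))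

-- The Minkowski-Weyl description of a cone by finitely many linear forms, possibly redundant. Its
-- converse half is strengthened to deliver a minimal representation; integrality makes the forms
-- integer-valued on lattice points.
record Facets {n m} (w : Fin n → Fin m → ℚ) : Set where
  field
    facets : List (Fin m → ℚ)
    integral : ∀ {a} → a ∈ facets → ∀ i → Integral (a i)
    sound : ∀ {y} → Cone w y → ∀ {a} → a ∈ facets → 0ℚ ≤ a ∙ y
    lexMin : ∀ y → (∀ {a} → a ∈ facets → 0ℚ ≤ a ∙ y) → ∃ (LexMin w y)

module _ {m : ℕ} (v y : Fin m → ℚ) where

  -- The candidate for the least coefficient of v in a representation of y. Only forms negative on v
  -- bound θ from below, and the last component certifies that θ cannot be lowered.
  Tight : List (Fin m → ℚ) → ℚ → Set
  Tight as θ = 0ℚ ≤ θ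
    × (∀ {a} → a ∈ as → a ∙ v < 0ℚ → 0ℚ ≤ a ∙ y - θ * (a ∙ v))
    × (θ ≡ 0ℚ ⊎ ∃ λ a → a ∈ as × a ∙ v < 0ℚ × a ∙ y ≡ θ * (a ∙ v))

  tight : ∀ as → ∃ (Tight as)
  tight [] = 0ℚ , ≤-refl , (λ ()) , inj₁ refl
  tight (a ∷ as) with tight as | a ∙ v <? 0ℚ
  ... | θ , θ≥0 , ok , att | no av≥0 = θ , θ≥0
      , (λ { (here refl) av<0 → contradiction av<0 av≥0 ; (there b∈) → ok b∈ })
      , Sum.map₂ (λ (b , b∈ , h) → b , there b∈ , h) att
  ... | θ , θ≥0 , ok , att | yes av<0 with 0ℚ ≤? a ∙ y - θ * (a ∙ v)
  ...   | yes h = θ , θ≥0 , (λ { (here refl) _ → h ; (there b∈) → ok b∈ })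
      , Sum.map₂ (λ (b , b∈ , h) → b , there b∈ , h) att
  ...   | no h = θ′ , <⇒≤ (≤-<-trans θ≥0 θ<θ′)
      , (λ { (here refl) _ → ℚ.≤-reflexive (sym (trans (cong (_- θ′ * (a ∙ v)) eq)
                 (ℚ.+-inverseʳ (θ′ * (a ∙ v)))))
           ; {b} (there b∈) bv<0 → subst (0ℚ ≤_)
               (solve 4 (λ p q θ θ′ → (p :- θ :* q) :+ (θ′ :- θ) :* (:- q) := p :- θ′ :* q)
                 refl (b ∙ y) (b ∙ v) θ θ′)
               (0≤+ (ok b∈ bv<0) (0≤* (<⇒≤ (<⇒0<- θ<θ′)) (<⇒≤ (neg-pos bv<0)))) })
      , inj₂ (a , here refl , av<0 , eq)
    where
    r = proj₁ (inverse (neg-pos av<0))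
    rv = proj₂ (proj₂ (inverse (neg-pos av<0)))
    -- The quotient of a ∙ y by a ∙ v, at which `a` becomes an equality. Raising θ to it only
    -- relaxes the earlier conditions, whose forms are negative on v.
    θ′ = - (a ∙ y) * r
    eq : a ∙ y ≡ θ′ * (a ∙ v)
    eq = sym (trans (solve 3 (λ p q r → (:- p) :* r :* q := p :* (r :* (:- q))) refl (a ∙ y) (a ∙ v) r)
      (trans (cong (a ∙ y *_) rv) (ℚ.*-identityʳ (a ∙ y))))
    θ<θ′ : θ < θ′
    θ<θ′ = 0<-⇒< (0<*⁻¹ (neg-pos av<0) (subst (0ℚ <_)
      (trans (cong (λ z → - (z - θ * (a ∙ v))) eq)
        (solve 3 (λ θ θ′ q → :- (θ′ :* q :- θ :* q) := (:- q) :* (θ′ :- θ)) refl θ θ′ (a ∙ v)))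
      (neg-pos (ℚ.≰⇒> h))))

  tight-minimal : ∀ {as θ ν} → Tight as θ → 0ℚ ≤ ν → (∀ {a} → a ∈ as → 0ℚ ≤ a ∙ y - ν * (a ∙ v)) → θ ≤ ν
  tight-minimal (_ , _ , inj₁ refl) ν≥0 _ = ν≥0
  tight-minimal {as} {θ} {ν} (_ , _ , inj₂ (a , a∈ , av<0 , eq)) ν≥0 h =
    0≤-⇒≤ (0≤*⁻¹ (neg-pos av<0) (subst (0ℚ ≤_)
      (trans (cong (_- ν * (a ∙ v)) eq)
        (solve 3 (λ θ ν q → θ :* q :- ν :* q := (:- q) :* (ν :- θ)) refl θ ν (a ∙ v)))
      (h a∈)))

∙-shift : ∀ {m} (a y v : Fin m → ℚ) θ → a ∙ (λ i → y i - θ * v i) ≡ a ∙ y - θ * (a ∙ v)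
∙-shift a y v θ = begin
  a ∙ (λ i → y i - θ * v i)          ≡⟨ ∙-congʳ a (λ i → cong (λ z → y i + z) (ℚ.neg-distribˡ-* θ (v i))) ⟩
  a ∙ (λ i → y i + (- θ) * v i)      ≡⟨ ∙-+ a y (λ i → (- θ) * v i) ⟩
  a ∙ y + a ∙ (λ i → (- θ) * v i)    ≡⟨ cong (λ z → a ∙ y + z) (∙-* a v (- θ)) ⟩
  a ∙ y + (- θ) * (a ∙ v)            ≡⟨ cong (λ z → a ∙ y + z) (sym (ℚ.neg-distribˡ-* θ (a ∙ v))) ⟩
  a ∙ y - θ * (a ∙ v) ∎
  where open ≡-Reasoning

-- Fourier–Motzkin elimination of the coefficient of v.
eliminate : ∀ {m} → (v a b : Fin m → ℚ) → Fin m → ℚ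
eliminate v a b i = b ∙ v * a i + (- (a ∙ v)) * b i

eliminate-∙ : ∀ {m} (v a b y : Fin m → ℚ) → eliminate v a b ∙ y ≡ b ∙ v * (a ∙ y) + (- (a ∙ v)) * (b ∙ y)
eliminate-∙ v a b y = trans (∙-+ˡ (λ i → b ∙ v * a i) (λ i → (- (a ∙ v)) * b i) y)
  (cong₂ _+_ (∙-*ˡ a y (b ∙ v)) (∙-*ˡ b y (- (a ∙ v))))

-- Without generators the cone is the origin, so every coordinate is bounded by 0 from both sides.
facets-nil : ∀ {m} (w : Fin 0 → Fin m → ℚ) → Facets w
facets-nil {m} w = record
  { facets = map δ (allFin m) ++ map (λ i j → - δ i j) (allFin m)
  ; integral = λ {a} a∈ → integral a∈
  ; sound = λ { (l , _ , eq) {a} a∈ → ℚ.≤-reflexive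
      (sym (∙-zero a (λ i → trans (eq i) (∙-nil l (λ j → w j i))))) }
  ; lexMin = λ y h → (λ ()) , ((λ ()) , λ i → trans (y≡0 h i) (sym (∙-nil _ _))) , λ _ _ ()
  }
  where
  δ-integral : ∀ {n} (i j : Fin n) → Integral (δ i j)
  δ-integral zero zero = ℤ.+ 1 , refl
  δ-integral zero (suc j) = ℤ.+ 0 , refl
  δ-integral (suc i) zero = ℤ.+ 0 , refl
  δ-integral (suc i) (suc j) = δ-integral i j
  integral : ∀ {a} → a ∈ map δ (allFin m) ++ map (λ i j → - δ i j) (allFin m) → ∀ i → Integral (a i)
  integral a∈ i with ∈-++⁻ (map δ (allFin m)) a∈
  ... | inj₁ a∈′ with ∈-map⁻ δ a∈′
  ...   | j , _ , refl = δ-integral j i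
  integral a∈ i | inj₂ a∈′ with ∈-map⁻ (λ i j → - δ i j) a∈′
  ...   | j , _ , refl = integral-neg (δ-integral j i)
  y≡0 : ∀ {y} → (∀ {a} → a ∈ map δ (allFin m) ++ map (λ i j → - δ i j) (allFin m) → 0ℚ ≤ a ∙ y)
    → ∀ i → y i ≡ 0ℚ
  y≡0 {y} h i = ≤-antisym
    (0≤-⇒≤ (subst (0ℚ ≤_) eq (h (∈-++⁺ʳ (map δ (allFin m)) (∈-map⁺ (λ i j → - δ i j) (∈-allFin i))))))
    (subst (0ℚ ≤_) (∙-δˡ i y) (h (∈-++⁺ˡ (∈-map⁺ δ (∈-allFin i)))))
    where
    eq : (λ j → - δ i j) ∙ y ≡ 0ℚ - y i
    eq = trans (∙-congˡ y (λ j → solve 1 (λ x → :- x := (:- con 1ℚ) :* x) refl (δ i j)))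
      (trans (∙-*ˡ (δ i) y (- 1ℚ)) (trans (cong (- 1ℚ *_) (∙-δˡ i y))
        (solve 1 (λ x → (:- con 1ℚ) :* x := con 0ℚ :- x) refl (y i))))

-- Forms nonnegative on v stay valid, and a negative form paired with a nonnegative one has a
-- nonnegative combination that vanishes on v. Conversely, give v its least coefficient θ: then y -
-- θ v satisfies the forms of the remaining cone, and induction minimises the other coefficients.
facets-cons : ∀ {n m} (w : Fin (suc n) → Fin m → ℚ) → (∀ i → Integral (w zero i))
  → Facets (w ∘ suc) → Facets w
facets-cons {n} {m} w v-integral F = record
  { facets = pos ++ cartesianProductWith (eliminate v) neg pos
  ; integral = integral
  ; sound = sound
  ; lexMin = lexMin
  }
  where
  module F = Facets F
  v = w zero
  neg = filter (λ a → a ∙ v <? 0ℚ) F.facets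
  pos = filter (λ a → 0ℚ ≤? a ∙ v) F.facets
  all = pos ++ cartesianProductWith (eliminate v) neg pos

  neg⁻ : ∀ {a} → a ∈ neg → a ∈ F.facets × a ∙ v < 0ℚ
  neg⁻ = ∈-filter⁻ (λ a → a ∙ v <? 0ℚ) {xs = F.facets}
  pos⁻ : ∀ {a} → a ∈ pos → a ∈ F.facets × 0ℚ ≤ a ∙ v
  pos⁻ = ∈-filter⁻ (λ a → 0ℚ ≤? a ∙ v) {xs = F.facets}

  integral : ∀ {a} → a ∈ all → ∀ i → Integral (a i)
  integral a∈ i with ∈-++⁻ pos a∈
  ... | inj₁ a∈′ = F.integral (proj₁ (pos⁻ a∈′)) i
  ... | inj₂ a∈′ with ∈-cartesianProductWith⁻ (eliminate v) neg pos a∈′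
  ...   | a , b , a∈ₙ , b∈ₚ , refl = integral-+
      (integral-* (integral-∙ bi v-integral) (ai i))
      (integral-* (integral-neg (integral-∙ ai v-integral)) (bi i))
    where
    ai = F.integral (proj₁ (neg⁻ a∈ₙ))
    bi = F.integral (proj₁ (pos⁻ b∈ₚ))

  rest : ∀ {y} {l : Fin (suc n) → ℚ} → Represents w y l
    → Represents (w ∘ suc) (λ i → y i - l zero * v i) (l ∘ suc)
  rest {y} {l} (l≥0 , eq) = l≥0 ∘ suc , λ i → trans
      (cong (_- l zero * v i) (trans (eq i) (∙-cons l (λ j → w j i))))
    (solve 2 (λ p q → (p :+ q) :- p := q) refl (l zero * v i) (comb (l ∘ suc) (w ∘ suc) i))

  residual≥0 : ∀ {y} {l : Fin (suc n) → ℚ} → Represents w y l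
    → ∀ {a} → a ∈ F.facets → 0ℚ ≤ a ∙ y - l zero * (a ∙ v)
  residual≥0 {y} {l} rep {a} a∈ = subst (0ℚ ≤_) (∙-shift a y v (l zero)) (F.sound (_ , rest rep) a∈)

  sound : ∀ {y} → Cone w y → ∀ {a} → a ∈ all → 0ℚ ≤ a ∙ y
  sound {y} (l , rep) {a} a∈ with ∈-++⁻ pos a∈
  ... | inj₁ a∈′ = subst (0ℚ ≤_)
      (solve 2 (λ p q → (p :- q) :+ q := p) refl (a ∙ y) (l zero * (a ∙ v)))
      (0≤+ (residual≥0 rep (proj₁ (pos⁻ a∈′))) (0≤* (proj₁ rep zero) (proj₂ (pos⁻ a∈′))))
  ... | inj₂ a∈′ with ∈-cartesianProductWith⁻ (eliminate v) neg pos a∈′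
  ...   | a , b , a∈ₙ , b∈ₚ , refl = subst (0ℚ ≤_)
      (trans (solve 5 (λ p q r s t → q :* (r :- t :* p) :+ (:- p) :* (s :- t :* q) := q :* r :+ (:- p) :* s)
          refl (a ∙ v) (b ∙ v) (a ∙ y) (b ∙ y) (l zero))
        (sym (eliminate-∙ v a b y)))
      (0≤+ (0≤* (proj₂ (pos⁻ b∈ₚ)) (residual≥0 rep (proj₁ (neg⁻ a∈ₙ))))
        (0≤* (<⇒≤ (neg-pos (proj₂ (neg⁻ a∈ₙ)))) (residual≥0 rep (proj₁ (pos⁻ b∈ₚ)))))

  lexMin : ∀ y → (∀ {a} → a ∈ all → 0ℚ ≤ a ∙ y) → ∃ (LexMin w y)
  lexMin y h with tight v y F.facets
  ... | θ , t@(θ≥0 , ok , att) = θ ◂ l , (l≥0 , repr) , minimal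
    where
    -- Subtracting θ v could violate a form `a` that is nonnegative on v. If θ is attained at a form
    -- `b`, the combination that eliminates v from `b` and `a`, divided by -(b ∙ v), is the wanted
    -- inequality.
    ok-nonNeg : (θ ≡ 0ℚ ⊎ ∃ λ b → b ∈ F.facets × b ∙ v < 0ℚ × b ∙ y ≡ θ * (b ∙ v))
      → ∀ {a} → a ∈ pos → 0ℚ ≤ a ∙ y - θ * (a ∙ v)
    ok-nonNeg (inj₁ θ≡0) {a} a∈ = subst (0ℚ ≤_)
      (trans (solve 2 (λ p q → p := p :- con 0ℚ :* q) refl (a ∙ y) (a ∙ v))
        (cong (λ z → a ∙ y - z * (a ∙ v)) (sym θ≡0)))
      (h (∈-++⁺ˡ a∈))
    ok-nonNeg (inj₂ (b , b∈ , bv<0 , eq)) {a} a∈ = 0≤*⁻¹ (neg-pos bv<0) (subst (0ℚ ≤_)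
      (trans (eliminate-∙ v b a y) (trans (cong (λ z → a ∙ v * z + (- (b ∙ v)) * (a ∙ y)) eq)
        (solve 4 (λ p q r θ → q :* (θ :* p) :+ (:- p) :* r := (:- p) :* (r :- θ :* q))
          refl (b ∙ v) (a ∙ v) (a ∙ y) θ)))
      (h (∈-++⁺ʳ pos (∈-cartesianProductWith⁺ (eliminate v) (∈-filter⁺ (λ a → a ∙ v <? 0ℚ) b∈ bv<0) a∈))))
    ok′ : ∀ {a} → a ∈ F.facets → 0ℚ ≤ a ∙ y - θ * (a ∙ v)
    ok′ {a} a∈ with a ∙ v <? 0ℚ
    ... | yes av<0 = ok a∈ av<0
    ... | no av≮0 = ok-nonNeg att (∈-filter⁺ (λ a → 0ℚ ≤? a ∙ v) a∈ (ℚ.≮⇒≥ av≮0))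
    sub = F.lexMin (λ i → y i - θ * v i) (λ {a} a∈ → subst (0ℚ ≤_) (sym (∙-shift a y v θ)) (ok′ a∈))
    l = proj₁ sub
    l≥0 : ∀ j → 0ℚ ≤ (θ ◂ l) j
    l≥0 zero = θ≥0
    l≥0 (suc j) = proj₁ (proj₁ (proj₂ sub)) j
    repr : ∀ i → y i ≡ comb (θ ◂ l) w i
    repr i = trans (solve 2 (λ p q → p := q :+ (p :- q)) refl (y i) (θ * v i))
      (trans (cong (λ z → θ * v i + z) (proj₂ (proj₁ (proj₂ sub)) i)) (sym (∙-cons (θ ◂ l) (λ j → w j i))))
    minimal : ∀ k → Represents w y k → ¬ LexPos (λ j → (θ ◂ l) j - k j)
    minimal k rep (inj₁ θ>k) = <-irrefl refl
      (<-≤-trans (0<-⇒< θ>k) (tight-minimal v y t (proj₁ rep zero) (residual≥0 rep)))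
    minimal k rep (inj₂ (θ≡k , pos)) = proj₂ (proj₂ sub) (k ∘ suc)
      (proj₁ rep ∘ suc , λ i → trans (cong (λ z → y i - z * v i) (-⇒≡ {θ} {k zero} θ≡k))
        (proj₂ (rest rep) i)) pos

facetsOf : ∀ {n m} (w : Fin n → Fin m → ℚ) → (∀ j i → Integral (w j i)) → Facets w
facetsOf {zero} w _ = facets-nil w
facetsOf {suc n} w h = facets-cons w (h zero) (facetsOf (w ∘ suc) (h ∘ suc))

∙-cong-* : ∀ {m} {a b y z : Fin m → ℚ} → (∀ i → a i * y i ≡ b i * z i) → a ∙ y ≡ b ∙ z
∙-cong-* {a = a} {b} {y} {z} h = trans (∙-def a y) (trans (∑-cong h) (sym (∙-def b z)))

δ-sym : ∀ {n} (i j : Fin n) → δ i j ≡ δ j i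
δ-sym zero zero = refl
δ-sym zero (suc j) = refl
δ-sym (suc i) zero = refl
δ-sym (suc i) (suc j) = δ-sym i j

-- Supports of minimal representations and the simplicial cones they span.

module _ {n m : ℕ} (w : Fin n → Fin m → ℚ) where

  Relation : (Fin n → ℚ) → Set
  Relation μ = ∀ i → comb μ w i ≡ 0ℚ

  HasSupport : Vec Bool n → (Fin n → ℚ) → Set
  HasSupport S l = (∀ j → lookup S j ≡ true → 0ℚ < l j) × (∀ j → lookup S j ≡ false → l j ≡ 0ℚ)

  -- Lexicographic minimality of a representation with support S, expressed through S alone so that
  -- it transfers from one point to another. These S are the simplices of the triangulation.
  Optimal : Vec Bool n → Set
  Optimal S = ∀ μ → Relation μ → (∀ j → 0ℚ < μ j → lookup S j ≡ true) → ¬ LexPos μ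

  positive-in-support : ∀ {S l} → HasSupport S l → ∀ j → 0ℚ < l j → lookup S j ≡ true
  positive-in-support {S} (_ , off) j l>0 with lookup S j in eq
  ... | true = refl
  ... | false = contradiction l>0 (<-irrefl (sym (off j eq)))

  support-nonNeg : ∀ {S l} → HasSupport S l → ∀ j → 0ℚ ≤ l j
  support-nonNeg {S} (on , off) j with lookup S j in eq
  ... | true = <⇒≤ (on j eq)
  ... | false = ℚ.≤-reflexive (sym (off j eq))

  comb-difference : ∀ k l i → comb (λ j → l j - k j) w i ≡ comb l w i - comb k w i
  comb-difference k l i = begin
    (λ j → l j - k j) ∙ v               ≡⟨ ∙-congˡ v (λ j → cong (l j +_) (neg (k j))) ⟩
    (λ j → l j + (- 1ℚ) * k j) ∙ v      ≡⟨ ∙-+ˡ l (λ j → (- 1ℚ) * k j) v ⟩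
    l ∙ v + (λ j → (- 1ℚ) * k j) ∙ v    ≡⟨ cong (l ∙ v +_) (trans (∙-*ˡ k v (- 1ℚ)) (sym (neg (k ∙ v)))) ⟩
    l ∙ v - k ∙ v ∎
    where
    open ≡-Reasoning
    v : Fin n → ℚ
    v j = w j i
    neg : ∀ x → - x ≡ (- 1ℚ) * x
    neg = solve 1 (λ x → :- x := (:- con 1ℚ) :* x) refl

  -- Positive entries of μ sit where l is positive, so a small multiple of μ can be subtracted from
  -- l without leaving the nonnegative vectors; the result would be lexicographically smaller than
  -- l.
  lexMin⇒optimal : ∀ {S y l} → LexMin w y l → HasSupport S l → Optimal S
  lexMin⇒optimal {S} {y} {l} ((l≥0 , rep) , minimal) (on , off) μ rel pos lex =
    minimal k (k≥0 , rep′) (lex-scale θ>0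
        (λ j → solve 2 (λ p q → p :- (p :- q) := q) refl (l j) (θ * μ j)) lex)
    where
    sm = small-witness (small-∀ (λ j → small-≤ (μ j) (l≥0 j) (λ μ>0 → on j (pos j μ>0))))
    θ = proj₁ sm
    θ>0 = proj₁ (proj₂ sm)
    k : Fin n → ℚ
    k j = l j - θ * μ j
    k≥0 : ∀ j → 0ℚ ≤ k j
    k≥0 j = ≤⇒0≤- (proj₂ (proj₂ sm) j)
    rep′ : ∀ i → y i ≡ comb k w i
    rep′ i = trans (rep i) (sym (trans (comb-difference (λ j → θ * μ j) l i)
      (trans (cong (λ z → comb l w i - z) (trans (∙-*ˡ μ (λ j → w j i) θ) (cong (θ *_) (rel i))))
        (solve 2 (λ p θ → p :- θ :* con 0ℚ := p) refl (comb l w i) θ))))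

  -- The difference of the two representations is a relation. If it is lexicographically positive,
  -- its positive entries lie in S, and if its negative is, they lie in T; both are excluded. So the
  -- relative interiors of distinct simplices are disjoint.
  optimal-unique : ∀ {S T k l y} → Optimal S → Optimal T → HasSupport S k → HasSupport T l
    → Represents w y k → Represents w y l → ∀ j → k j ≡ l j
  optimal-unique {S} {T} {k} {l} {y} oS oT sS sT (k≥0 , repk) (l≥0 , repl) with lex-cmp (λ j → k j - l j)
  ... | inj₂ (inj₂ eq) = λ j → -⇒≡ (eq j)
  ... | inj₁ lex = ⊥-elim (oS (λ j → k j - l j)
      (λ i → trans (comb-difference l k i)
        (trans (cong₂ _-_ (sym (repk i)) (sym (repl i))) (ℚ.+-inverseʳ (y i))))
      (λ j h → positive-in-support {S} sS j (≤-<-trans (l≥0 j) (0<-⇒< h))) lex)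
  ... | inj₂ (inj₁ lex) = ⊥-elim (oT (λ j → - (k j - l j))
      (λ i → trans (∙-congˡ (λ j → w j i) (λ j → flip (k j) (l j)))
        (trans (comb-difference k l i)
          (trans (cong₂ _-_ (sym (repl i)) (sym (repk i))) (ℚ.+-inverseʳ (y i)))))
      (λ j h → positive-in-support {T} sT j
        (≤-<-trans (k≥0 j) (0<-⇒< (subst (0ℚ <_) (flip (k j) (l j)) h)))) lex)
    where
    flip : ∀ p q → - (p - q) ≡ q - p
    flip = solve 2 (λ p q → :- (p :- q) := q :- p) refl

  support-unique : ∀ {S T l} → HasSupport S l → HasSupport T l → S ≡ T
  support-unique {S} {T} {l} sS sT =
    trans (sym (Vec.tabulate∘lookup S)) (trans (Vec.tabulate-cong same) (Vec.tabulate∘lookup T))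
    where
    same : ∀ j → lookup S j ≡ lookup T j
    same j with lookup S j in eqS | lookup T j in eqT
    ... | true | true = refl
    ... | false | false = refl
    ... | true | false = contradiction (proj₁ sS j eqS) (<-irrefl (sym (proj₂ sT j eqT)))
    ... | false | true = contradiction (proj₁ sT j eqT) (<-irrefl (sym (proj₂ sS j eqS)))

  -- A nonzero relation is lexicographically positive up to sign, and inside S either sign
  -- contradicts optimality. So the cones are simplicial.
  optimal-independent : ∀ {S} → Optimal S → ∀ μ → Relation μ → (∀ j → lookup S j ≡ false → μ j ≡ 0ℚ)
    → ∀ j → μ j ≡ 0ℚ
  optimal-independent {S} oS μ rel off = cases (lex-cmp μ)
    where
    inside : ∀ j → μ j ≢ 0ℚ → lookup S j ≡ true
    inside j h with lookup S j in eq
    ... | true = refl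
    ... | false = contradiction (off j eq) h
    cases : LexPos μ ⊎ LexPos (λ j → - μ j) ⊎ (∀ j → μ j ≡ 0ℚ) → ∀ j → μ j ≡ 0ℚ
    cases (inj₂ (inj₂ eq)) = eq
    cases (inj₁ lex) = ⊥-elim (oS μ rel (λ j h → inside j (λ eq → <-irrefl (sym eq) h)) lex)
    cases (inj₂ (inj₁ lex)) = ⊥-elim (oS (λ j → - μ j)
      (λ i → trans (∙-congˡ (λ j → w j i) (λ j → solve 1 (λ x → :- x := (:- con 1ℚ) :* x) refl (μ j)))
        (trans (∙-*ˡ μ (λ j → w j i) (- 1ℚ)) (trans (cong (- 1ℚ *_) (rel i)) (ℚ.*-zeroʳ (- 1ℚ)))))
      (λ j h → inside j (λ eq → <-irrefl (sym (cong (-_) eq)) h)) lex)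

  -- The generators in S form a basis and `coord` is its dual basis. All generators keep their
  -- indices, with zero forms outside S, so that no reindexing of S is involved.
  record Basis (S : Vec Bool n) : Set where
    field
      coord : Fin n → Fin m → ℚ
      coord-off : ∀ j → lookup S j ≡ false → ∀ i → coord j i ≡ 0ℚ
      expand : ∀ y i → y i ≡ comb (λ j → coord j ∙ y) w i
      dual : ∀ k → lookup S k ≡ true → ∀ j → coord j ∙ w k ≡ δ k j

    coord∙-off : ∀ j → lookup S j ≡ false → ∀ y → coord j ∙ y ≡ 0ℚ
    coord∙-off j eq y = ∙-zeroˡ y (coord-off j eq)

    coord-unique : ∀ {y l} → (∀ j → lookup S j ≡ false → l j ≡ 0ℚ) → (∀ i → y i ≡ comb l w i)
      → ∀ j → coord j ∙ y ≡ l j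
    coord-unique {y} {l} off rep j = begin
      coord j ∙ y                     ≡⟨ ∙-congʳ (coord j) rep ⟩
      coord j ∙ comb l w              ≡⟨ ∙-swap (coord j) l w ⟩
      l ∙ (λ k → coord j ∙ w k)       ≡⟨ ∙-cong-* termwise ⟩
      δ j ∙ l                         ≡⟨ ∙-δˡ j l ⟩
      l j ∎
      where
      open ≡-Reasoning
      termwise : ∀ k → l k * (coord j ∙ w k) ≡ δ j k * l k
      termwise k with lookup S k in eq
      ... | true = trans (cong (l k *_) (trans (dual k eq j) (δ-sym k j))) (ℚ.*-comm (l k) (δ j k))
      ... | false = trans (cong (_* (coord j ∙ w k)) (off k eq)) (trans (ℚ.*-zeroˡ (coord j ∙ w k))
          (sym (trans (cong (δ j k *_) (off k eq)) (ℚ.*-zeroʳ (δ j k)))))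

    -- The trace of the identity, computed in the basis S and in the standard basis. It shows that S
    -- has exactly m members.
    trace : ∑ (λ j → if lookup S j then 1ℚ else 0ℚ) ≡ ∑ {m} (λ _ → 1ℚ)
    trace = begin
      ∑ (λ j → if lookup S j then 1ℚ else 0ℚ)  ≡⟨ ∑-cong diagonal ⟩
      ∑ (λ j → coord j ∙ w j)                  ≡⟨ ∑-cong (λ j → ∙-def (coord j) (w j)) ⟩
      ∑ (λ j → ∑ (λ i → coord j i * w j i))    ≡⟨ ∑-swap (λ j i → coord j i * w j i) ⟩
      ∑ (λ i → ∑ (λ j → coord j i * w j i))    ≡⟨ ∑-cong (λ i → column i) ⟩
      ∑ (λ i → 1ℚ) ∎
      where
      open ≡-Reasoning
      diagonal : ∀ j → (if lookup S j then 1ℚ else 0ℚ) ≡ coord j ∙ w j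
      diagonal j with lookup S j in eq
      ... | true = sym (trans (dual j eq j) (δ-refl j))
      ... | false = sym (coord∙-off j eq (w j))
      column : ∀ i → ∑ (λ j → coord j i * w j i) ≡ 1ℚ
      column i = begin
        ∑ (λ j → coord j i * w j i)      ≡⟨ ∙-def (λ j → coord j i) (λ j → w j i) ⟨
        (λ j → coord j i) ∙ (λ j → w j i) ≡⟨ ∙-congˡ (λ j → w j i)
          (λ j → trans (∙-comm (coord j) (δ i)) (∙-δˡ i (coord j))) ⟨
        comb (λ j → coord j ∙ δ i) w i   ≡⟨ expand (δ i) i ⟨
        δ i i                            ≡⟨ δ-refl i ⟩
        1ℚ ∎

  -- Generators outside S are replaced by zero rather than deleted, which leaves the cone of S
  -- unchanged and keeps the index type.
  restrict : Vec Bool n → Fin n → Fin m → ℚ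
  restrict S j i = if lookup S j then w j i else 0ℚ

  mask : Vec Bool n → (Fin n → ℚ) → Fin n → ℚ
  mask S l j = if lookup S j then l j else 0ℚ

  mask-off : ∀ S l j → lookup S j ≡ false → mask S l j ≡ 0ℚ
  mask-off S l j eq rewrite eq = refl

  comb-restrict : ∀ S l i → comb l (restrict S) i ≡ comb (mask S l) w i
  comb-restrict S l i = ∙-cong-* termwise
    where
    termwise : ∀ j → l j * restrict S j i ≡ mask S l j * w j i
    termwise j with lookup S j
    ... | true = refl
    ... | false = trans (ℚ.*-zeroʳ (l j)) (sym (ℚ.*-zeroˡ (w j i)))

  restrict-integral : (∀ j i → Integral (w j i)) → ∀ S j i → Integral (restrict S j i)
  restrict-integral h S j i with lookup S j
  ... | true = h j i
  ... | false = ℤ.+ 0 , refl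

  support⇒restrict : ∀ {S l y} → HasSupport S l → Represents w y l → Represents (restrict S) y l
  support⇒restrict {S} {l} (_ , off) (l≥0 , rep) = l≥0 , λ i → trans (rep i)
    (sym (trans (comb-restrict S l i) (∙-congˡ (λ j → w j i) unmask)))
    where
    unmask : ∀ j → mask S l j ≡ l j
    unmask j with lookup S j in eq
    ... | true = refl
    ... | false = sym (off j eq)

  -- The first alternative is there because elimination can produce the zero form, which no point
  -- avoids.
  Generic : List (Fin m → ℚ) → (Fin m → ℚ) → Set
  Generic H y = ∀ {h} → h ∈ H → (∀ z → h ∙ z ≡ 0ℚ) ⊎ h ∙ y ≢ 0ℚ

  -- A point on no facet hyperplane of the cone lies in its interior, so the generators span.
  generic-spans : ∀ {S y} (F : Facets (restrict S)) → Generic (Facets.facets F) y → Cone (restrict S) y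
    → ∀ z → Σ (Fin n → ℚ) λ γ → (∀ j → lookup S j ≡ false → γ j ≡ 0ℚ) × (∀ i → z i ≡ comb γ w i)
  generic-spans {S} {y} F gen (k , k≥0 , repk) z = γ
      , (λ j eq → trans (cong (r *_) (cong₂ _-_ (mask-off S l j eq) (mask-off S k j eq))) (ℚ.*-zeroʳ r))
      , repc
    where
    module F = Facets F
    sm = small-witness (small-∈ F.facets small)
      where
      small : ∀ {a} → a ∈ F.facets → Small (λ θ → θ * (- (a ∙ z)) ≤ a ∙ y)
      small {a} a∈ = small-≤ (- (a ∙ z)) (F.sound (k , k≥0 , repk) a∈) positive
        where
        positive : 0ℚ < - (a ∙ z) → 0ℚ < a ∙ y
        positive az with gen a∈
        ... | inj₁ a≡0 = contradiction az (<-irrefl (sym (cong (-_) (a≡0 z))))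
        ... | inj₂ ay≢0 with <-cmp (a ∙ y) 0ℚ
        ...   | tri< lt _ _ = contradiction (<-≤-trans lt (F.sound (k , k≥0 , repk) a∈)) (<-irrefl refl)
        ...   | tri≈ _ eq _ = contradiction eq ay≢0
        ...   | tri> _ _ gt = gt
    θ = proj₁ sm
    moved = F.lexMin (λ i → y i + θ * z i) λ {a} a∈ → subst (0ℚ ≤_)
      (trans (solve 3 (λ p q θ → p :- θ :* (:- q) := p :+ θ :* q) refl (a ∙ y) (a ∙ z) θ)
        (sym (trans (∙-+ a y (λ i → θ * z i)) (cong (a ∙ y +_) (∙-* a z θ)))))
      (≤⇒0≤- (proj₂ (proj₂ sm) a∈))
    l = proj₁ moved
    inv = inverse (proj₁ (proj₂ sm))
    r = proj₁ inv
    -- The vector z is the difference of y + θ z and y, divided by θ. The former lies in the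
    -- restricted cone too, as each form is either zero or positive at y and θ is small.
    γ : Fin n → ℚ
    γ j = r * (mask S l j - mask S k j)
    repc : ∀ i → z i ≡ comb γ w i
    repc i = sym (begin
      comb γ w i
        ≡⟨ ∙-*ˡ (λ j → mask S l j - mask S k j) (λ j → w j i) r ⟩
      r * comb (λ j → mask S l j - mask S k j) w i
        ≡⟨ cong (r *_) (comb-difference (mask S k) (mask S l) i) ⟩
      r * (comb (mask S l) w i - comb (mask S k) w i)
        ≡⟨ cong (r *_) (cong₂ _-_
             (trans (sym (comb-restrict S l i)) (sym (proj₂ (proj₁ (proj₂ moved)) i)))
             (trans (sym (comb-restrict S k i)) (sym (repk i)))) ⟩
      r * (y i + θ * z i - y i)
        ≡⟨ solve 4 (λ r y θ z → r :* (y :+ θ :* z :- y) := r :* θ :* z) refl r (y i) θ (z i) ⟩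
      r * θ * z i
        ≡⟨ trans (cong (_* z i) (proj₂ (proj₂ inv))) (ℚ.*-identityˡ (z i)) ⟩
      z i ∎)
      where open ≡-Reasoning

  -- Expanding the unit vectors over S gives the matrix of the coordinate forms.
  optimal-spanning⇒basis : ∀ {S} → Optimal S
    → (∀ z → Σ (Fin n → ℚ) λ γ → (∀ j → lookup S j ≡ false → γ j ≡ 0ℚ) × (∀ i → z i ≡ comb γ w i))
    → Basis S
  optimal-spanning⇒basis {S} oS span = record
    { coord = U ; coord-off = λ j eq i → proj₁ (proj₂ (span (δ i))) j eq ; expand = expand ; dual = dual }
    where
    U : Fin n → Fin m → ℚ
    U j i = proj₁ (span (δ i)) j
    expand : ∀ y i → y i ≡ comb (λ j → U j ∙ y) w i
    expand y i = sym (begin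
      (λ j → U j ∙ y) ∙ v                     ≡⟨ ∙-comm (λ j → U j ∙ y) v ⟩
      v ∙ (λ j → U j ∙ y)                     ≡⟨ ∙-congʳ v (λ j → ∙-comm (U j) y) ⟩
      v ∙ (λ j → y ∙ U j)                     ≡⟨ ∙-swap v y (λ i j → U j i) ⟩
      y ∙ (λ i′ → v ∙ (λ j → U j i′))         ≡⟨ ∙-congʳ y (λ i′ → trans (∙-comm v (λ j → U j i′))
                                                   (trans (sym (proj₂ (proj₂ (span (δ i′))) i))
                                                     (δ-sym i′ i))) ⟩
      y ∙ δ i                                 ≡⟨ trans (∙-comm y (δ i)) (∙-δˡ i y) ⟩
      y i ∎)
      where
      open ≡-Reasoning
      v : Fin n → ℚ
      v j = w j i
    dual : ∀ k → lookup S k ≡ true → ∀ j → U j ∙ w k ≡ δ k j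
    -- Both sides are the coefficients of an expansion of w k over S, and S is independent.
    dual k k∈ j = -⇒≡ (optimal-independent {S} oS (λ j → U j ∙ w k - δ k j) rel off j)
      where
      rel : Relation (λ j → U j ∙ w k - δ k j)
      rel i = trans (comb-difference (δ k) (λ j → U j ∙ w k) i)
        (trans (cong₂ _-_ (sym (expand (w k) i)) (∙-δˡ k (λ j → w j i))) (ℚ.+-inverseʳ (w k i)))
      off : ∀ j → lookup S j ≡ false → U j ∙ w k - δ k j ≡ 0ℚ
      off j eq = cong₂ _-_ (∙-zeroˡ (w k) (λ i → proj₁ (proj₂ (span (δ i))) j eq))
        (δ-≢ {i = k} {j} (λ { refl → contradiction (trans (sym k∈) eq) λ () }))

-- Generic points of a cone.

cone-+ : ∀ {n m} {w : Fin n → Fin m → ℚ} {x y} → Cone w x → Cone w y → Cone w (λ i → x i + y i)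
cone-+ {w = w} (k , k≥0 , repk) (l , l≥0 , repl) = (λ j → k j + l j) , (λ j → 0≤+ (k≥0 j) (l≥0 j))
  , λ i → trans (cong₂ _+_ (repk i) (repl i)) (sym (∙-+ˡ k l (λ j → w j i)))

cone-* : ∀ {n m} {w : Fin n → Fin m → ℚ} {y θ} → 0ℚ ≤ θ → Cone w y → Cone w (λ i → θ * y i)
cone-* {w = w} {θ = θ} θ≥0 (l , l≥0 , rep) = (λ j → θ * l j) , (λ j → 0≤* θ≥0 (l≥0 j))
  , λ i → trans (cong (θ *_) (rep i)) (sym (∙-*ˡ l (λ j → w j i) θ))

cone-height : ∀ {n m} {w : Fin n → Fin (suc m) → ℚ} → (∀ j → w j zero ≡ 1ℚ)
  → ∀ {y} → Cone w y → 0ℚ ≤ y zero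
cone-height w-height (l , l≥0 , rep) = subst (0ℚ ≤_) (sym (rep zero))
  (∙-nonNeg l≥0 (λ j → subst (0ℚ ≤_) (sym (w-height j)) (<⇒≤ 0<1)))

small-≢0 : ∀ p q → Small (λ θ → p ≢ 0ℚ → p + θ * q ≢ 0ℚ)
small-≢0 p q with <-cmp p 0ℚ
... | tri≈ _ p≡0 _ = small-always λ _ _ p≢0 → contradiction p≡0 p≢0
... | tri> _ _ p>0 with small-< (- q) p>0
...   | θ₀ , θ₀>0 , h = θ₀ , θ₀>0 , λ θ θ>0 θ≤ _ eq → <-irrefl (sym eq) (subst (0ℚ <_)
    (solve 3 (λ p q θ → p :- θ :* (:- q) := p :+ θ :* q) refl p q θ) (<⇒0<- (h θ θ>0 θ≤)))
small-≢0 p q | tri< p<0 _ _ with small-< q (neg-pos p<0)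
...   | θ₀ , θ₀>0 , h = θ₀ , θ₀>0 , λ θ θ>0 θ≤ _ eq → <-irrefl (sym (cong (-_) eq)) (subst (0ℚ <_)
    (solve 3 (λ p q θ → (:- p) :- θ :* q := :- (p :+ θ :* q)) refl p q θ) (<⇒0<- (h θ θ>0 θ≤)))

-- Generators are added one by one with small coefficients: a form already nonzero at ξ stays
-- nonzero, and a form that vanished on all earlier generators becomes nonzero as soon as it is
-- nonzero on the new one.
generic-point : ∀ {n m} (w : Fin n → Fin m → ℚ) (H : List (Fin m → ℚ))
  → ∃ λ ξ → Cone w ξ × (∀ {h} → h ∈ H → (∀ j → h ∙ w j ≡ 0ℚ) ⊎ h ∙ ξ ≢ 0ℚ)
generic-point {zero} w H = (λ _ → 0ℚ) , ((λ ()) , (λ ()) , λ i → sym (∙-nil (λ ()) (λ j → w j i)))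
  , λ _ → inj₁ λ ()
generic-point {suc n} w H with generic-point (w ∘ suc) H
... | ξ , (l , l≥0 , rep) , gen = ξ′ , (θ ◂ l , nonNeg , rep′) , gen′
  where
  v = w zero
  sm = small-witness (small-∈ H (λ {h} _ → small-≢0 (h ∙ ξ) (h ∙ v)))
  θ = proj₁ sm
  θ>0 = proj₁ (proj₂ sm)
  ξ′ = λ i → ξ i + θ * v i
  nonNeg : ∀ j → 0ℚ ≤ (θ ◂ l) j
  nonNeg zero = <⇒≤ θ>0
  nonNeg (suc j) = l≥0 j
  rep′ : ∀ i → ξ′ i ≡ comb (θ ◂ l) w i
  rep′ i = trans (ℚ.+-comm (ξ i) (θ * v i))
    (trans (cong (λ z → θ * v i + z) (rep i)) (sym (∙-cons (θ ◂ l) (λ j → w j i))))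
  eval : ∀ h → h ∙ ξ′ ≡ h ∙ ξ + θ * (h ∙ v)
  eval h = trans (∙-+ h ξ (λ i → θ * v i)) (cong (λ z → h ∙ ξ + z) (∙-* h v θ))
  gen′ : ∀ {h} → h ∈ H → (∀ j → h ∙ w j ≡ 0ℚ) ⊎ h ∙ ξ′ ≢ 0ℚ
  gen′ {h} h∈ with h ∙ ξ ≟ 0ℚ | h ∙ v ≟ 0ℚ | gen h∈
  ... | no ne | _ | _ = inj₂ λ eq → proj₂ (proj₂ sm) h∈ ne (trans (sym (eval h)) eq)
  ... | yes eq | _ | inj₂ ne = contradiction eq ne
  ... | yes _ | yes hv | inj₁ z = inj₁ λ { zero → hv ; (suc j) → z j }
  ... | yes hξ | no hv | inj₁ _ = inj₂ λ eq → hv (p*q≡0⇒q≡0 θ>0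
      (trans (sym (ℚ.+-identityˡ _)) (trans (cong (_+ θ * (h ∙ v)) (sym hξ)) (trans (sym (eval h)) eq))))

-- Scaling keeps genericity. The bound 1 is the gap between integers: a perturbation below it cannot
-- cancel a nonzero integer or make a negative one nonnegative.
small-generic-point : ∀ {n m} (w : Fin n → Fin m → ℚ) (H : List (Fin m → ℚ))
  → ∃ λ ξ → Cone w ξ × (∀ {h} → h ∈ H → ((∀ j → h ∙ w j ≡ 0ℚ) ⊎ h ∙ ξ ≢ 0ℚ) × h ∙ ξ < 1ℚ × - (h ∙ ξ) < 1ℚ)
small-generic-point w H = (λ i → θ * ξ i) , cone-* {w = w} (<⇒≤ θ>0) cone , λ {h} h∈ →
    Sum.map₂ (λ ne eq → ne (p*q≡0⇒q≡0 θ>0 (trans (sym (∙-* h ξ θ)) eq))) (gen h∈)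
    , subst (_< 1ℚ) (sym (∙-* h ξ θ)) (proj₁ (bound h∈))
    , subst (_< 1ℚ) (trans (sym (ℚ.neg-distribʳ-* θ (h ∙ ξ))) (cong (-_) (sym (∙-* h ξ θ))))
      (proj₂ (bound h∈))
  where
  point = generic-point w H
  ξ = proj₁ point
  cone = proj₁ (proj₂ point)
  gen = proj₂ (proj₂ point)
  sm = small-witness (small-∈ H (λ {h} _ →
    small-× (small-< (h ∙ ξ) 0<1) (small-< (- (h ∙ ξ)) 0<1)))
  θ = proj₁ sm
  θ>0 = proj₁ (proj₂ sm)
  bound = proj₂ (proj₂ sm)

-- The cells of the triangulation.

subsets : ∀ n → List (Vec Bool n)
subsets zero = [] ∷ []
subsets (suc n) = map (true ∷_) (subsets n) ++ map (false ∷_) (subsets n)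

∈-subsets : ∀ {n} (S : Vec Bool n) → S ∈ subsets n
∈-subsets [] = here refl
∈-subsets (true ∷ S) = ∈-++⁺ˡ (∈-map⁺ (true ∷_) (∈-subsets S))
∈-subsets (false ∷ S) = ∈-++⁺ʳ (map (true ∷_) (subsets _)) (∈-map⁺ (false ∷_) (∈-subsets S))

does-true : ∀ {P : Set} (d : Dec P) → does d ≡ true → P
does-true (yes p) _ = p

does-false : ∀ {P : Set} (d : Dec P) → does d ≡ false → ¬ P
does-false (no ¬p) _ = ¬p

IntegralPoint : ∀ {m} → (Fin m → ℚ) → Set
IntegralPoint x = ∀ i → Integral (x i)

integral+small≢0 : ∀ {p q} → Integral p → q ≢ 0ℚ → q < 1ℚ → - q < 1ℚ → p + q ≢ 0ℚ
integral+small≢0 {p} {q} ip q≢0 q<1 -q<1 eq with integral-cases ip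
... | inj₂ (inj₁ refl) = q≢0 (trans (sym (ℚ.+-identityˡ q)) eq)
... | inj₂ (inj₂ 1≤p) = <-irrefl (sym eq) (subst (0ℚ <_)
    (solve 2 (λ p q → (con 1ℚ :- (:- q)) :+ (p :- con 1ℚ) := p :+ q) refl p q)
    (0<+ (<⇒0<- -q<1) (≤⇒0≤- 1≤p)))
... | inj₁ p≤-1 = <-irrefl (sym (cong (-_) eq)) (subst (0ℚ <_)
    (solve 2 (λ p q → (con 1ℚ :- q) :+ ((:- con 1ℚ) :- p) := :- (p :+ q)) refl p q)
    (0<+ (<⇒0<- q<1) (≤⇒0≤- p≤-1)))

integral+small≥0 : ∀ {p q} → Integral p → q < 1ℚ → 0ℚ ≤ p + q → 0ℚ ≤ p
integral+small≥0 {p} {q} ip q<1 h with integral-cases ip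
... | inj₂ (inj₁ refl) = ≤-refl
... | inj₂ (inj₂ 1≤p) = ≤-trans (<⇒≤ 0<1) 1≤p
... | inj₁ p≤-1 = ⊥-elim (<-irrefl refl (<-≤-trans (0<+ (<⇒0<- q<1) (≤⇒0≤- p≤-1)) (0≤-⇒≤ (subst (0ℚ ≤_)
    (solve 2 (λ p q → p :+ q := con 0ℚ :- ((con 1ℚ :- q) :+ ((:- con 1ℚ) :- p))) refl p q) h))))

-- The cells are the maximal cones of the triangulation induced by lexicographically minimal
-- representations; looking up x + ξ instead of x makes them half-open and disjoint.
module Triangulation {n m : ℕ} (w : Fin n → Fin (suc m) → ℚ)
  (w-integral : ∀ (j : Fin n) → IntegralPoint (w j))
  (w-spans : ∀ (z : Fin (suc m) → ℚ) → Σ (Fin n → ℚ) λ γ → ∀ (i : Fin (suc m)) → z i ≡ comb γ w i)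
  (w-height : ∀ (j : Fin n) → w j zero ≡ 1ℚ) where

  F = facetsOf w w-integral
  module F = Facets F
  FS : ∀ S → Facets (restrict w S)
  FS S = facetsOf (restrict w S) (restrict-integral w w-integral S)

  -- The height form makes ξ have positive height, the forms of the whole cone keep lattice points
  -- from entering it, and those of the subcones put x + ξ off every wall. All subsets are included
  -- because ξ is chosen before any cell is known.
  hyperplanes : List (Fin (suc m) → ℚ)
  hyperplanes = δ zero ∷ F.facets ++ concatMap (Facets.facets ∘ FS) (subsets n)

  abstract
    generic : ∃ λ ξ → Cone w ξ × (∀ {h} → h ∈ hyperplanes
      → ((∀ j → h ∙ w j ≡ 0ℚ) ⊎ h ∙ ξ ≢ 0ℚ) × h ∙ ξ < 1ℚ × - (h ∙ ξ) < 1ℚ)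
    generic = small-generic-point w hyperplanes

  ξ : Fin (suc m) → ℚ
  ξ = proj₁ generic

  ξ-cone : Cone w ξ
  ξ-cone = proj₁ (proj₂ generic)

  shift : (Fin (suc m) → ℚ) → Fin (suc m) → ℚ
  shift x i = x i + ξ i

  vanishing : ∀ {h} → (∀ j → h ∙ w j ≡ 0ℚ) → ∀ z → h ∙ z ≡ 0ℚ
  vanishing {h} h≡0 z with w-spans z
  ... | γ , rep = trans (∙-congʳ h rep) (trans (∙-swap h γ w) (∙-zero γ h≡0))

  ξ-height>0 : 0ℚ < ξ zero
  ξ-height>0 with <-cmp (ξ zero) 0ℚ
  ... | tri> _ _ gt = gt
  ... | tri< lt _ _ = contradiction (<-≤-trans lt (cone-height w-height ξ-cone)) (<-irrefl refl)
  ... | tri≈ _ eq _ with proj₁ (proj₂ (proj₂ generic) (here refl))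
  ...   | inj₂ ne = contradiction (trans (∙-δˡ zero ξ) eq) ne
  ...   | inj₁ h = contradiction
    (trans (sym (∙-δˡ zero (λ _ → 1ℚ))) (vanishing h (λ _ → 1ℚ))) (λ ())

  shift-generic : ∀ S {x} → IntegralPoint x → Generic w (Facets.facets (FS S)) (shift x)
  shift-generic S {x} ix {h} h∈ with proj₂ (proj₂ generic)
      (there (∈-++⁺ʳ F.facets (∈-concatMap⁺ (Facets.facets ∘ FS) (lose (∈-subsets S) h∈))))
  ... | inj₁ h≡0 , _ = inj₁ (vanishing h≡0)
  ... | inj₂ h≢0 , h<1 , -h<1 = inj₂ λ eq →
    integral+small≢0 (integral-∙ (Facets.integral (FS S) h∈) ix) h≢0 h<1 -h<1 (trans (sym (∙-+ h x ξ)) eq)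

  shift-cone : ∀ {x} → Cone w x → Cone w (shift x)
  shift-cone c = cone-+ {w = w} c ξ-cone

  -- On x each form takes an integer value, which exceeds -1 because the perturbation contributes
  -- less than 1; hence it is at least 0.
  unshift-cone : ∀ {x} → IntegralPoint x → Cone w (shift x) → Cone w x
  unshift-cone {x} ix c = _ , proj₁ (proj₂ (F.lexMin x λ {a} a∈ →
    integral+small≥0 (integral-∙ (F.integral a∈) ix)
      (proj₁ (proj₂ (proj₂ (proj₂ generic) (there (∈-++⁺ˡ a∈)))))
      (subst (0ℚ ≤_) (∙-+ a x ξ) (F.sound c a∈))))

  supportOf : (Fin n → ℚ) → Vec Bool n
  supportOf l = tabulate (λ j → does (0ℚ <? l j))

  hasSupport : ∀ {l} → (∀ j → 0ℚ ≤ l j) → HasSupport w (supportOf l) l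
  hasSupport {l} l≥0 = on , off
    where
    on : ∀ j → lookup (supportOf l) j ≡ true → 0ℚ < l j
    on j eq = does-true (0ℚ <? l j) (trans (sym (Vec.lookup∘tabulate _ j)) eq)
    off : ∀ j → lookup (supportOf l) j ≡ false → l j ≡ 0ℚ
    off j eq = ≤-antisym (ℚ.≮⇒≥ (does-false (0ℚ <? l j) (trans (sym (Vec.lookup∘tabulate _ j)) eq))) (l≥0 j)

  cell : (Fin (suc m) → ℚ) → Vec Bool n
  cell x with all? (λ a → 0ℚ ≤? a ∙ shift x) F.facets
  ... | yes h = supportOf (proj₁ (F.lexMin (shift x) (All.lookup h)))
  -- A default for x + ξ outside the cone; `cell-optimal` rules this case out for x in the cone.
  ... | no _ = replicate n false

  cell-optimal : ∀ {x} → Cone w x → Optimal w (cell x)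
    × ∃ λ l → HasSupport w (cell x) l × Represents w (shift x) l
  cell-optimal {x} c with all? (λ a → 0ℚ ≤? a ∙ shift x) F.facets
  ... | no h = contradiction (All.tabulate (F.sound (shift-cone c))) h
  ... | yes h with F.lexMin (shift x) (All.lookup h)
  ...   | l , lm@(rep , _) = lexMin⇒optimal w {supportOf l} lm sup , l , sup , rep
    where sup = hasSupport (proj₁ rep)

  -- Since x + ξ lies on no wall, the simplicial cone that carries it is full-dimensional.
  cell-basis : ∀ {x} → IntegralPoint x → Cone w x → Basis w (cell x)
  cell-basis {x} ix c with cell x | cell-optimal c
  ... | S | opt , l , sup , rep = optimal-spanning⇒basis w {S} opt
    (generic-spans w {S} (FS S) (shift-generic S ix) (l , support⇒restrict w {S} sup rep))

  InCell : ∀ {S} → Basis w S → (Fin (suc m) → ℚ) → Set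
  InCell {S} B x = ∀ j → lookup S j ≡ true → 0ℚ < Basis.coord B j ∙ shift x

  cell⇒inCell : ∀ {S} (B : Basis w S) {x} → Cone w x → cell x ≡ S → InCell B x
  cell⇒inCell B {x} c refl j j∈ with cell-optimal c
  ... | _ , l , sup , (_ , rep) =
    subst (0ℚ <_) (sym (Basis.coord-unique B {l = l} (proj₂ sup) rep j)) (proj₁ sup j j∈)

  -- The coordinates themselves represent x + ξ with support S. So x lies in the cone, and
  -- uniqueness among optimal supports identifies S as its cell.
  inCell⇒cell : ∀ {S} (B : Basis w S) → Optimal w S → ∀ {x} → IntegralPoint x → InCell B x
    → Cone w x × cell x ≡ S
  inCell⇒cell {S} B opt {x} ix pos = x∈ , support-unique w {l = l}
      (subst-support {cell x} (optimal-unique w {cell x} {S} optₓ opt supₓ sup repₓ rep) supₓ) sup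
    where
    l = λ j → Basis.coord B j ∙ shift x
    sup : HasSupport w S l
    sup = pos , λ j eq → Basis.coord∙-off B j eq (shift x)
    rep : Represents w (shift x) l
    rep = support-nonNeg w {S} sup , Basis.expand B (shift x)
    x∈ : Cone w x
    x∈ = unshift-cone ix (l , rep)
    optₓ = proj₁ (cell-optimal x∈)
    supₓ = proj₁ (proj₂ (proj₂ (cell-optimal x∈)))
    repₓ = proj₂ (proj₂ (proj₂ (cell-optimal x∈)))
    subst-support : ∀ {T k} → (∀ j → k j ≡ l j) → HasSupport w T k → HasSupport w T l
    subst-support eq (on , off) = (λ j h → subst (0ℚ <_) (eq j) (on j h))
      , λ j h → trans (sym (eq j)) (off j h)

-- Finite differences.

Δ : (ℕ → ℚ) → ℕ → ℚ
Δ f s = f (suc s) - f s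

Δ^ : ℕ → (ℕ → ℚ) → ℕ → ℚ
Δ^ zero f = f
Δ^ (suc n) f = Δ^ n (Δ f)

Δ^-cong : ∀ n {f g} → (∀ s → f s ≡ g s) → ∀ s → Δ^ n f s ≡ Δ^ n g s
Δ^-cong zero h = h
Δ^-cong (suc n) h = Δ^-cong n (λ s → cong₂ _-_ (h (suc s)) (h s))

Δ^-shift : ∀ n f s → Δ^ n (f ∘ suc) s ≡ Δ^ n f (suc s)
Δ^-shift zero f s = refl
Δ^-shift (suc n) f s = Δ^-shift n (Δ f) s

Δ^-+ : ∀ n f g s → Δ^ n (λ s → f s + g s) s ≡ Δ^ n f s + Δ^ n g s
Δ^-+ zero f g s = refl
Δ^-+ (suc n) f g s = trans
  (Δ^-cong n (λ s → solve 4 (λ p q r t → (p :+ r) :- (q :+ t) := (p :- q) :+ (r :- t)) refl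
    (f (suc s)) (f s) (g (suc s)) (g s)) s)
  (Δ^-+ n (Δ f) (Δ g) s)

Δ^-− : ∀ n f g s → Δ^ n (λ s → f s - g s) s ≡ Δ^ n f s - Δ^ n g s
Δ^-− zero f g s = refl
Δ^-− (suc n) f g s = trans
  (Δ^-cong n (λ s → solve 4 (λ p q r t → (p :- r) :- (q :- t) := (p :- q) :- (r :- t)) refl
    (f (suc s)) (f s) (g (suc s)) (g s)) s)
  (Δ^-− n (Δ f) (Δ g) s)

Δ^-suc : ∀ n f s → Δ^ (suc n) f s ≡ Δ^ n f (suc s) - Δ^ n f s
Δ^-suc n f s = trans (Δ^-− n (f ∘ suc) f s) (cong (_- Δ^ n f s) (Δ^-shift n f s))

Δ^-zero : ∀ n {f} → (∀ s → f s ≡ 0ℚ) → ∀ s → Δ^ n f s ≡ 0ℚ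
Δ^-zero zero h = h
Δ^-zero (suc n) {f} h = Δ^-zero n (λ s → cong₂ _-_ (h (suc s)) (h s))

-- Product rule: the difference of (s + b) g is (s + 1 + b) Δ g + g. The constant b grows along the
-- induction, which is why it is arbitrary.
Δ^-linear-* : ∀ n {g} → (∀ s → Δ^ n g s ≡ 0ℚ) → ∀ b s → Δ^ (suc n) (λ s → (ℕ→ℚ s + b) * g s) s ≡ 0ℚ
Δ^-linear-* n {g} h b s = trans
    (Δ^-cong n (λ s → trans (cong (λ z → (z + b) * g (suc s) - (ℕ→ℚ s + b) * g s)
      (sym (/1-+ (ℤ.+ 1) (ℤ.+ s))))
      (solve 4 (λ t b p q → (con 1ℚ :+ t :+ b) :* p :- (t :+ b) :* q
                          := (t :+ (con 1ℚ :+ b)) :* (p :- q) :+ q)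
        refl (ℕ→ℚ s) b (g (suc s)) (g s))) s)
    (trans (Δ^-+ n (λ s → (ℕ→ℚ s + (1ℚ + b)) * Δ g s) g s)
      (trans (cong₂ _+_ (product n h) (h s)) (ℚ.+-identityˡ 0ℚ)))
  where
  product : ∀ n → (∀ s → Δ^ n g s ≡ 0ℚ) → Δ^ n (λ s → (ℕ→ℚ s + (1ℚ + b)) * Δ g s) s ≡ 0ℚ
  product zero h = trans (cong ((ℕ→ℚ s + (1ℚ + b)) *_) (cong₂ _-_ (h (suc s)) (h s)))
      (ℚ.*-zeroʳ (ℕ→ℚ s + (1ℚ + b)))
  product (suc n) h = Δ^-linear-* n h (1ℚ + b) s

-- Horner's scheme multiplies by the argument once per coefficient, and each multiplication costs
-- one more difference.
Δ^-poly : ∀ {n} (L : Vec ℚ n) b s → Δ^ n (λ s → evalPoly L (ℕ→ℚ s + b)) s ≡ 0ℚ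
Δ^-poly [] b s = refl
Δ^-poly {suc n} (a ∷ L) b s = trans
  (Δ^-+ (suc n) (λ _ → a) (λ s → (ℕ→ℚ s + b) * evalPoly L (ℕ→ℚ s + b)) s)
  (trans (cong₂ _+_ (Δ^-zero n (λ _ → ℚ.+-inverseʳ a) s) (Δ^-linear-* n (Δ^-poly L b) b s))
    (ℚ.+-identityˡ 0ℚ))

±1 : ℕ → ℚ
±1 zero = 1ℚ
±1 (suc n) = - ±1 n

-- In the alternating binomial sum only the terms with binomials 1 and n survive. This is the origin
-- of the factor D + 1 beside L(-1).
Δ^-two-terms : ∀ n {E} s → (∀ k → E (suc (suc (k ℕ.+ s))) ≡ 0ℚ)
  → Δ^ n E s ≡ ±1 n * (E s - ℕ→ℚ n * E (suc s))
Δ^-two-terms zero {E} s h = solve 2 (λ p q → p := con 1ℚ :* (p :- con 0ℚ :* q)) refl (E s) (E (suc s))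
Δ^-two-terms (suc n) {E} s h = begin
  Δ^ (suc n) E s
    ≡⟨ Δ^-suc n E s ⟩
  Δ^ n E (suc s) - Δ^ n E s
    ≡⟨ cong₂ _-_ (Δ^-two-terms n (suc s)
        (λ k → trans (cong (λ z → E (suc (suc z))) (ℕ.+-suc k s)) (h (suc k))))
         (Δ^-two-terms n s h) ⟩
  ±1 n * (E (suc s) - ℕ→ℚ n * E (suc (suc s))) - ±1 n * (E s - ℕ→ℚ n * E (suc s))
    ≡⟨ cong (λ z → ±1 n * (E (suc s) - ℕ→ℚ n * z) - ±1 n * (E s - ℕ→ℚ n * E (suc s))) (h 0) ⟩
  ±1 n * (E (suc s) - ℕ→ℚ n * 0ℚ) - ±1 n * (E s - ℕ→ℚ n * E (suc s))
    ≡⟨ solve 4 (λ e n p q → e :* (q :- n :* con 0ℚ) :- e :* (p :- n :* q)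
                          := (:- e) :* (p :- (con 1ℚ :+ n) :* q)) refl (±1 n) (ℕ→ℚ n) (E s) (E (suc s)) ⟩
  ±1 (suc n) * (E s - (1ℚ + ℕ→ℚ n) * E (suc s))
    ≡⟨ cong (λ z → ±1 (suc n) * (E s - z * E (suc s))) (/1-+ (ℤ.+ 1) (ℤ.+ n)) ⟩
  ±1 (suc n) * (E s - ℕ→ℚ (suc n) * E (suc s)) ∎
  where open ≡-Reasoning

-- Counting in lists and in half-open simplicial cones.

unique-length : ∀ {A : Set} {xs ys : List A} → Unique xs → Unique ys
  → (∀ {x} → x ∈ xs → x ∈ ys) → (∀ {x} → x ∈ ys → x ∈ xs) → length xs ≡ length ys
unique-length uxs uys f g = ↭-length (∼bag⇒↭ (unique∧set⇒bag uxs uys (mk⇔ f g)))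

count : ∀ {A : Set} {P : A → Set} → Decidable P → List A → ℕ
count P? xs = length (filter P? xs)

count-cong : ∀ {A : Set} {P Q : A → Set} (P? : Decidable P) (Q? : Decidable Q) xs
  → (∀ {x} → x ∈ xs → P x → Q x) → (∀ {x} → x ∈ xs → Q x → P x) → count P? xs ≡ count Q? xs
count-cong P? Q? [] f g = refl
count-cong P? Q? (x ∷ xs) f g with P? x | Q? x | count-cong P? Q? xs (f ∘ there) (g ∘ there)
... | yes _ | yes _ | ih = cong suc ih
... | no _ | no _ | ih = ih
... | yes p | no ¬q | _ = contradiction (f (here refl) p) ¬q
... | no ¬p | yes q | _ = contradiction (g (here refl) q) ¬p

count-split : ∀ {A : Set} {P Q : A → Set} (P? : Decidable P) (Q? : Decidable Q) xs
  → count P? xs ≡ count (λ x → Q? x ×-dec P? x) xs ℕ.+ count (λ x → ¬? (Q? x) ×-dec P? x) xs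
count-split P? Q? [] = refl
count-split P? Q? (x ∷ xs) with P? x | Q? x | count-split P? Q? xs
... | yes _ | yes _ | ih = cong suc ih
... | yes _ | no _ | ih = trans (cong suc ih) (sym (ℕ.+-suc _ _))
... | no _ | yes _ | ih = ih
... | no _ | no _ | ih = ih

count-filter : ∀ {A : Set} {P Q : A → Set} (P? : Decidable P) (Q? : Decidable Q) xs
  → count P? (filter Q? xs) ≡ count (λ x → Q? x ×-dec P? x) xs
count-filter P? Q? [] = refl
count-filter P? Q? (x ∷ xs) with Q? x | count-filter P? Q? xs
... | no _ | ih = ih
... | yes _ | ih with P? x
...   | yes _ = cong suc ih
...   | no _ = ih

-- Removing the shifted copy of the half-open cone cuts the coordinate j down to (0 , 1],
-- so the full difference operator counts the lattice points of the fundamental box.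
module BoxCount {A : Set} {n : ℕ} (ys : ℕ → List A) (ys-unique : ∀ (s : ℕ) → Unique (ys s))
  (u : Fin n → ℕ → A → ℚ) (move move⁻ : Fin n → A → A)
  (move-move⁻ : ∀ (j : Fin n) (x : A) → move j (move⁻ j x) ≡ x)
  (move⁻-move : ∀ (j : Fin n) (x : A) → move⁻ j (move j x) ≡ x)
  (js : List (Fin n)) (js-unique : Unique js)
  (u-move : ∀ {j : Fin n} {s : ℕ} {x : A} → j ∈ js → u j (suc s) (move j x) ≡ u j s x + 1ℚ)
  (u-move-≢ : ∀ {j k : Fin n} {s : ℕ} {x : A} → j ∈ js → k ∈ js → j ≢ k → u k (suc s) (move j x) ≡ u k s x)
  where

  Pos : ℕ → A → Set
  Pos s x = ∀ {j} → j ∈ js → 0ℚ < u j s x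

  Pos? : ∀ s → Decidable (Pos s)
  Pos? s x with all? (λ j → 0ℚ <? u j s x) js
  ... | yes h = yes (All.lookup h)
  ... | no h = no λ p → h (All.tabulate p)

  -- An intermediate stage: the coordinates in `ks` are already cut down to (0 , 1], the others are
  -- only positive.
  Bounded : List (Fin n) → ℕ → A → Set
  Bounded ks s x = Pos s x × All (λ k → u k s x ≤ 1ℚ) ks

  Bounded? : ∀ ks s → Decidable (Bounded ks s)
  Bounded? ks s x = Pos? s x ×-dec all? (λ k → u k s x ≤? 1ℚ) ks

  module _ (complete : ∀ {s : ℕ} {x : A} → Pos s x → x ∈ ys s) where

    -- Translation by generator j is a bijection here: it raises coordinate j by 1 and fixes the
    -- other coordinates in `js`, so positive becomes greater than 1.
    shifted : ∀ {j ks} → j ∈ js → (∀ {k} → k ∈ ks → k ∈ js × j ≢ k) → ∀ s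
      → count (λ x → ¬? (u j (suc s) x ≤? 1ℚ) ×-dec Bounded? ks (suc s) x) (ys (suc s))
        ≡ count (Bounded? ks s) (ys s)
    shifted {j} {ks} j∈ ks⊆ s = sym (trans (sym (length-map (move j) lower))
      (unique-length (Unique.map⁺ injective (Unique.filter⁺ (Bounded? ks s) (ys-unique s)))
        (Unique.filter⁺ U? (ys-unique (suc s))) to from))
      where
      U? = λ x → ¬? (u j (suc s) x ≤? 1ℚ) ×-dec Bounded? ks (suc s) x
      lower = filter (Bounded? ks s) (ys s)
      upper = filter U? (ys (suc s))
      injective : ∀ {x y} → move j x ≡ move j y → x ≡ y
      injective {x} {y} eq = trans (sym (move⁻-move j x)) (trans (cong (move⁻ j) eq) (move⁻-move j y))
      up : ∀ {x} → Bounded ks s x → ¬ (u j (suc s) (move j x) ≤ 1ℚ) × Bounded ks (suc s) (move j x)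
      up {x} (pos , bound) = (λ le → <-irrefl refl (<-≤-trans 1<u le)) , pos′
        , All.tabulate λ {k} k∈ → subst (_≤ 1ℚ) (sym (u-move-≢ j∈ (proj₁ (ks⊆ k∈)) (proj₂ (ks⊆ k∈))))
          (All.lookup bound k∈)
        where
        1<u : 1ℚ < u j (suc s) (move j x)
        1<u = subst₂ _<_ (ℚ.+-identityˡ 1ℚ) (sym (u-move j∈)) (ℚ.+-monoˡ-< 1ℚ (pos j∈))
        pos′ : Pos (suc s) (move j x)
        pos′ {k} k∈ with j Fin.≟ k
        ... | yes refl = <-trans 0<1 1<u
        ... | no j≢k = subst (0ℚ <_) (sym (u-move-≢ j∈ k∈ j≢k)) (pos k∈)
      down : ∀ {x} → ¬ (u j (suc s) (move j x) ≤ 1ℚ) → Bounded ks (suc s) (move j x) → Bounded ks s x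
      down {x} u≰1 (pos , bound) = pos′ , All.tabulate λ {k} k∈ →
          subst (_≤ 1ℚ) (u-move-≢ j∈ (proj₁ (ks⊆ k∈)) (proj₂ (ks⊆ k∈))) (All.lookup bound k∈)
        where
        pos′ : Pos s x
        pos′ {k} k∈ with j Fin.≟ k
        ... | yes refl = subst (0ℚ <_)
          (trans (cong (_- 1ℚ) (u-move j∈)) (solve 1 (λ p → p :+ con 1ℚ :- con 1ℚ := p) refl (u j s x)))
          (<⇒0<- (ℚ.≰⇒> u≰1))
        ... | no j≢k = subst (0ℚ <_) (u-move-≢ j∈ k∈ j≢k) (pos k∈)
      to : ∀ {x} → x ∈ map (move j) lower → x ∈ upper
      to x∈ with ∈-map⁻ (move j) x∈
      ... | x , x∈′ , refl = ∈-filter⁺ U? (complete (proj₁ (proj₂ moved))) moved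
        where moved = up (proj₂ (∈-filter⁻ (Bounded? ks s) {xs = ys s} x∈′))
      from : ∀ {x} → x ∈ upper → x ∈ map (move j) lower
      from {x} x∈ = subst (_∈ map (move j) lower) (move-move⁻ j x)
        (∈-map⁺ (move j) (∈-filter⁺ (Bounded? ks s) (complete (proj₁ below)) below))
        where
        above : ¬ (u j (suc s) (move j (move⁻ j x)) ≤ 1ℚ) × Bounded ks (suc s) (move j (move⁻ j x))
        above = subst (λ z → ¬ (u j (suc s) z ≤ 1ℚ) × Bounded ks (suc s) z) (sym (move-move⁻ j x))
          (proj₂ (∈-filter⁻ U? {xs = ys (suc s)} x∈))
        below = down (proj₁ above) (proj₂ above)

    bounded : List (Fin n) → ℕ → ℚ
    bounded ks s = ℕ→ℚ (count (Bounded? ks s) (ys s))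

    -- Split the points of index s + 1 by whether coordinate j exceeds 1; those where it does cancel
    -- against index s.
    Δ-bounded : ∀ {j ks} → j ∈ js → (∀ {k} → k ∈ ks → k ∈ js × j ≢ k) → ∀ s
      → Δ (bounded ks) s ≡ bounded (j ∷ ks) (suc s)
    Δ-bounded {j} {ks} j∈ ks⊆ s = begin
      bounded ks (suc s) - bounded ks s
        ≡⟨ cong (λ z → ℕ→ℚ z - bounded ks s) (trans
             (count-split (Bounded? ks (suc s)) (λ x → u j (suc s) x ≤? 1ℚ) (ys (suc s)))
             (cong₂ ℕ._+_ regroup (shifted j∈ ks⊆ s))) ⟩
      ℕ→ℚ (box ℕ.+ count (Bounded? ks s) (ys s)) - bounded ks s
        ≡⟨ cong (_- bounded ks s) (/1-+ (ℤ.+ box) (ℤ.+ count (Bounded? ks s) (ys s))) ⟨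
      ℕ→ℚ box + bounded ks s - bounded ks s
        ≡⟨ solve 2 (λ p q → p :+ q :- q := p) refl (ℕ→ℚ box) (bounded ks s) ⟩
      ℕ→ℚ box ∎
      where
      open ≡-Reasoning
      box = count (Bounded? (j ∷ ks) (suc s)) (ys (suc s))
      regroup : count (λ x → (u j (suc s) x ≤? 1ℚ) ×-dec Bounded? ks (suc s) x) (ys (suc s)) ≡ box
      regroup = count-cong _ (Bounded? (j ∷ ks) (suc s)) (ys (suc s))
        (λ { _ (b , pos , bs) → pos , b ∷ bs }) (λ { _ (pos , b ∷ bs) → b , pos , bs })

    -- Every difference bounds one further coordinate and raises the index by one, so the box is
    -- counted at the end of the range of the difference.
    Δ^-bounded : ∀ rest {ks} → Unique rest → (∀ {j} → j ∈ rest → j ∈ js)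
      → (∀ {k} → k ∈ ks → k ∈ js × All (_≢ k) rest)
      → ∀ s → Δ^ (length rest) (bounded ks) s ≡ bounded (rest ʳ++ ks) (length rest ℕ.+ s)
    Δ^-bounded [] _ _ _ s = refl
    Δ^-bounded (j ∷ rest) {ks} (j∉ ∷ uniq) rest⊆ ks⊆ s = begin
      Δ^ (length rest) (Δ (bounded ks)) s
        ≡⟨ Δ^-cong (length rest) (Δ-bounded (rest⊆ (here refl))
            (λ k∈ → proj₁ (ks⊆ k∈) , All.head (proj₂ (ks⊆ k∈)))) s ⟩
      Δ^ (length rest) (bounded (j ∷ ks) ∘ suc) s
        ≡⟨ Δ^-shift (length rest) (bounded (j ∷ ks)) s ⟩
      Δ^ (length rest) (bounded (j ∷ ks)) (suc s)
        ≡⟨ Δ^-bounded rest uniq (rest⊆ ∘ there)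
             (λ { (here refl) → rest⊆ (here refl) , All.map (λ ne eq → ne (sym eq)) j∉
                ; (there k∈) → proj₁ (ks⊆ k∈) , All.tail (proj₂ (ks⊆ k∈)) }) (suc s) ⟩
      bounded (rest ʳ++ (j ∷ ks)) (length rest ℕ.+ suc s)
        ≡⟨ cong (bounded (rest ʳ++ (j ∷ ks))) (ℕ.+-suc (length rest) s) ⟩
      bounded (rest ʳ++ (j ∷ ks)) (suc (length rest ℕ.+ s)) ∎
      where open ≡-Reasoning

    Δ^-positive : ∀ s → Δ^ (length js) (λ s → ℕ→ℚ (count (Pos? s) (ys s))) s
      ≡ bounded (js ʳ++ []) (length js ℕ.+ s)
    Δ^-positive s = trans
      (Δ^-cong (length js) (λ s → cong ℕ→ℚ (count-cong (Pos? s) (Bounded? [] s) (ys s)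
        (λ _ p → p , []) (λ _ → proj₁))) s)
      (Δ^-bounded js js-unique id (λ ()) s)

-- Splitting a count along labels.

module Labelled (Φ : (ℕ → ℚ) → Set)
  (Φ-cong : ∀ {f g : ℕ → ℚ} → (∀ (s : ℕ) → f s ≡ g s) → Φ f → Φ g)
  (Φ-+ : ∀ {f g : ℕ → ℚ} → Φ f → Φ g → Φ (λ s → f s + g s)) where

  _≟ᵛ_ : ∀ {n} (S T : Vec Bool n) → Dec (S ≡ T)
  _≟ᵛ_ = Vec.≡-dec Bool._≟_

  -- Labels are split off bit by bit, so closure of Φ under sums of two functions is enough.
  sum-over-labels : ∀ {A : Set} {n} (label : ℕ → A → Vec Bool n) (ys : ℕ → List A)
    → (∀ S → Φ (λ s → ℕ→ℚ (count (λ x → label s x ≟ᵛ S) (ys s)))) → Φ (λ s → ℕ→ℚ (length (ys s)))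
  sum-over-labels {n = zero} label ys h = Φ-cong
    (λ s → cong (λ xs → ℕ→ℚ (length xs)) (everything s)) (h [])
    where
    trivial : (S : Vec Bool 0) → S ≡ []
    trivial [] = refl
    everything : ∀ s → filter (λ x → label s x ≟ᵛ []) (ys s) ≡ ys s
    everything s = filter-all _ (All.tabulate λ {x} _ → trivial (label s x))
  sum-over-labels {A} {suc n} label ys h = Φ-cong total (Φ-+ (part true) (part false))
    where
    first? : ∀ b s (x : A) → Dec (head (label s x) ≡ b)
    first? b s x = head (label s x) Bool.≟ b
    half : Bool → ℕ → List A
    half b s = filter (first? b s) (ys s)
    part : ∀ b → Φ (λ s → ℕ→ℚ (length (half b s)))
    part b = sum-over-labels (λ s x → tail (label s x)) (half b) λ S →
        Φ-cong (λ s → cong ℕ→ℚ (sym (relabel S s))) (h (b ∷ S))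
      where
      join : ∀ {S} (T : Vec Bool (suc n)) → head T ≡ b → tail T ≡ S → T ≡ b ∷ S
      join (_ ∷ _) refl refl = refl
      relabel : ∀ S s → count (λ x → tail (label s x) ≟ᵛ S) (half b s)
        ≡ count (λ x → label s x ≟ᵛ (b ∷ S)) (ys s)
      relabel S s = trans
        (count-filter (λ x → tail (label s x) ≟ᵛ S) (first? b s) (ys s))
        (count-cong _ (λ x → label s x ≟ᵛ (b ∷ S)) (ys s)
          (λ {x} _ (p , q) → join (label s x) p q) (λ {x} _ eq → cong head eq , cong tail eq))
    total : ∀ s → ℕ→ℚ (length (half true s)) + ℕ→ℚ (length (half false s)) ≡ ℕ→ℚ (length (ys s))
    total s = trans (/1-+ (ℤ.+ length (half true s)) (ℤ.+ length (half false s)))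
        (cong ℕ→ℚ (sym (halves (ys s))))
      where
      halves : ∀ xs → length xs ≡ count (first? true s) xs ℕ.+ count (first? false s) xs
      halves [] = refl
      halves (x ∷ xs) with head (label s x)
      ... | true = cong suc (halves xs)
      ... | false = trans (cong suc (halves xs)) (sym (ℕ.+-suc _ _))

-- The weighted sum in terms of L(-2) and L(-1).

±1-sgn : ∀ k → ℤ→ℚ (sgn k) ≡ ±1 k
±1-sgn zero = refl
±1-sgn (suc k) = trans (sym (/1-neg (sgn k))) (cong -_ (±1-sgn k))

parity : ∀ k → (k % 2 ≡ 0 × ±1 k ≡ 1ℚ) ⊎ (k % 2 ≡ 1 × ±1 k ≡ - 1ℚ)
parity zero = inj₁ (refl , refl)
parity (suc zero) = inj₂ (refl , refl)
parity (suc (suc k)) with parity k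
... | inj₁ (eq , s) = inj₁ (eq , cong (λ z → - (- z)) s)
... | inj₂ (eq , s) = inj₂ (eq , cong (λ z → - (- z)) s)

2^ : ℕ → ℚ
2^ k = ℕ→ℚ (2 ℕ.^ k)

2^-suc : ∀ k → 2^ (suc k) ≡ (1ℚ + 1ℚ) * 2^ k
2^-suc k = trans (cong ℤ→ℚ (ℤ.pos-* 2 (2 ℕ.^ k))) (sym (/1-* (ℤ.+ 2) (ℤ.+ (2 ℕ.^ k))))

excess : ∀ d k → ℤ→ℚ (ℤ.+ (2 ℕ.^ k) ℤ.- ℤ.+ 1 ℤ.- ℤ.+ d) ≡ 2^ k - 1ℚ - ℕ→ℚ d
excess d k = trans (sym (/1-+ (ℤ.+ (2 ℕ.^ k) ℤ.- ℤ.+ 1) (ℤ.- (ℤ.+ d))))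
  (cong₂ _+_ (sym (/1-+ (ℤ.+ (2 ℕ.^ k)) (ℤ.- (ℤ.+ 1)))) (sym (/1-neg (ℤ.+ d))))

-- The parity cases merge into the sign (-1)^k, and the separately defined c₀ fits because 2^0 - (1
-- + d) is -d.
coefficient : ∀ d k → ℤ→ℚ (c d k) ≡ ±1 d * ±1 k * (2^ k - (1ℚ + ℕ→ℚ d))
coefficient d zero = trans (sym (/1-* (sgn (suc d)) (ℤ.+ d)))
  (trans (cong (_* ℕ→ℚ d) (±1-sgn (suc d)))
    (solve 2 (λ e n → (:- e) :* n := e :* con 1ℚ :* (con 1ℚ :- (con 1ℚ :+ n))) refl (±1 d) (ℕ→ℚ d)))
coefficient d (suc j) with suc j % 2 | parity (suc j)
... | zero | inj₁ (_ , s) = trans (sym (/1-* (sgn d) (ℤ.+ (2 ℕ.^ suc j) ℤ.- ℤ.+ 1 ℤ.- ℤ.+ d)))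
  (trans (cong₂ _*_ (±1-sgn d) (excess d (suc j)))
    (trans (solve 3 (λ e p n → e :* (p :- con 1ℚ :- n) := e :* con 1ℚ :* (p :- (con 1ℚ :+ n))) refl
        (±1 d) (2^ (suc j)) (ℕ→ℚ d))
      (cong (λ z → ±1 d * z * (2^ (suc j) - (1ℚ + ℕ→ℚ d))) (sym s))))
... | suc _ | inj₂ (_ , s) = trans (sym (/1-* (sgn (suc d)) (ℤ.+ (2 ℕ.^ suc j) ℤ.- ℤ.+ 1 ℤ.- ℤ.+ d)))
  (trans (cong₂ _*_ (±1-sgn (suc d)) (excess d (suc j)))
    (trans (solve 3 (λ e p n → (:- e) :* (p :- con 1ℚ :- n) := e :* (:- con 1ℚ) :*
      (p :- (con 1ℚ :+ n))) refl
        (±1 d) (2^ (suc j)) (ℕ→ℚ d))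
      (cong (λ z → ±1 d * z * (2^ (suc j) - (1ℚ + ℕ→ℚ d))) (sym s))))

weightedTail : (d k : ℕ) → ∀ {m} → Vec ℚ m → ℚ
weightedTail d k [] = 0ℚ
weightedTail d k (a ∷ as) = ℤ→ℚ (c d k) * a + weightedTail d (suc k) as

-- The local function go of weightedSum cannot be named; it is the solution of the underscore, found
-- by unification once the with-abstraction has made all its arguments distinct variables.
mutual
  go≡weightedTail : ∀ d (L : Vec ℚ (suc d)) {m} k (as : Vec ℚ m) → _ ≡ weightedTail d k as

  weightedSum≡weightedTail : ∀ d (L : Vec ℚ (suc (suc d))) → weightedSum (suc d) L
    ≡ weightedTail (suc d) 0 L
  weightedSum≡weightedTail d (a ∷ b ∷ as)
    with suc d | a Vec.∷ b Vec.∷ as | 2 | ℤ→ℚ (c (suc d) 0) * a | ℤ→ℚ (c (suc d) 1) * b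
  ... | d′ | L | k | p | q = cong (λ z → p + (q + z)) (go≡weightedTail d′ L k as)

  go≡weightedTail d L k [] = refl
  go≡weightedTail d L k (a ∷ as) = cong (ℤ→ℚ (c d k) * a +_) (go≡weightedTail d L (suc k) as)

-1ℚ -2ℚ : ℚ
-1ℚ = - 1ℚ
-2ℚ = - (1ℚ + 1ℚ)

-- Induction along Horner's scheme, with the offset k carried along: passing to k + 1 flips the sign
-- and doubles the power, which amounts to multiplying by -2 in the first evaluation and by -1 in
-- the second.
weightedTail-eval : ∀ d k {m} (L : Vec ℚ m)
  → weightedTail d k L ≡ ±1 d * ±1 k * (2^ k * evalPoly L -2ℚ - (1ℚ + ℕ→ℚ d) * evalPoly L -1ℚ)
weightedTail-eval d k [] = solve 4
    (λ e s p n → con 0ℚ := e :* s :* (p :* con 0ℚ :- (con 1ℚ :+ n) :* con 0ℚ))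
  refl (±1 d) (±1 k) (2^ k) (ℕ→ℚ d)
weightedTail-eval d k (a ∷ L) = begin
  ℤ→ℚ (c d k) * a + weightedTail d (suc k) L
    ≡⟨ cong₂ (λ x y → x * a + y) (coefficient d k) (weightedTail-eval d (suc k) L) ⟩
  e * s * (2^ k - (1ℚ + N)) * a + e * (- s) * (2^ (suc k) * E₂ - (1ℚ + N) * E₁)
    ≡⟨ cong (λ z → e * s * (2^ k - (1ℚ + N)) * a + e * (- s) * (z * E₂ - (1ℚ + N) * E₁)) (2^-suc k) ⟩
  e * s * (2^ k - (1ℚ + N)) * a + e * (- s) * ((1ℚ + 1ℚ) * 2^ k * E₂ - (1ℚ + N) * E₁)
    ≡⟨ solve 7 (λ e s p n a x y →
           e :* s :* (p :- (con 1ℚ :+ n)) :* a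
             :+ e :* (:- s) :* ((con 1ℚ :+ con 1ℚ) :* p :* x :- (con 1ℚ :+ n) :* y)
           := e :* s :* (p :* (a :+ (:- (con 1ℚ :+ con 1ℚ)) :* x) :- (con 1ℚ :+ n) :*
               (a :+ (:- con 1ℚ) :* y)))
         refl e s (2^ k) N a E₂ E₁ ⟩
  e * s * (2^ k * (a + -2ℚ * E₂) - (1ℚ + N) * (a + -1ℚ * E₁)) ∎
  where
  open ≡-Reasoning
  e = ±1 d
  s = ±1 k
  N = ℕ→ℚ d
  E₂ = evalPoly L -2ℚ
  E₁ = evalPoly L -1ℚ

weightedSum-eval : ∀ d (L : Vec ℚ (suc (suc d)))
  → weightedSum (suc d) L ≡ ±1 (suc d) * (evalPoly L -2ℚ - ℕ→ℚ (suc (suc d)) * evalPoly L -1ℚ)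
weightedSum-eval d L = trans (weightedSum≡weightedTail d L) (trans (weightedTail-eval (suc d) 0 L)
  (trans (solve 4 (λ e x y n → e :* con 1ℚ :* (con 1ℚ :* x :- n :* y) := e :* (x :- n :* y)) refl
      (±1 (suc d)) (evalPoly L -2ℚ) (evalPoly L -1ℚ) (1ℚ + ℕ→ℚ (suc d)))
    (cong (λ z → ±1 (suc d) * (evalPoly L -2ℚ - z * evalPoly L -1ℚ)) (/1-+ (ℤ.+ 1) (ℤ.+ suc d)))))

-- The cone over the polytope.

ℤ→ℚ-injective : ∀ {x y} → ℤ→ℚ x ≡ ℤ→ℚ y → x ≡ y
ℤ→ℚ-injective {x} {y} eq with ℚ.fromℚᵘ-injective {mkℚᵘ x 0} {mkℚᵘ y 0} eq
... | *≡* h = trans (sym (ℤ.*-identityʳ x)) (trans h (ℤ.*-identityʳ y))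

ℕ→ℚ-suc : ∀ n → ℕ→ℚ (suc n) ≡ 1ℚ + ℕ→ℚ n
ℕ→ℚ-suc n = sym (/1-+ (ℤ.+ 1) (ℤ.+ n))

ℕ→ℚ-nonNeg : ∀ n → 0ℚ ≤ ℕ→ℚ n
ℕ→ℚ-nonNeg n = /1-mono-≤ {ℤ.+ 0} {ℤ.+ n} (ℤ.+≤+ ℕ.z≤n)

∑-one : ∀ n → ∑ {n} (λ _ → 1ℚ) ≡ ℕ→ℚ n
∑-one zero = ∑-nil (λ _ → 1ℚ)
∑-one (suc n) = trans (∑-cons {n} (λ _ → 1ℚ)) (trans (cong (1ℚ +_) (∑-one n)) (sym (ℕ→ℚ-suc n)))

∙-one : ∀ {n} (l : Fin n → ℚ) → l ∙ (λ _ → 1ℚ) ≡ ∑ l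
∙-one l = trans (∙-def l (λ _ → 1ℚ)) (∑-cong (λ i → ℚ.*-identityʳ (l i)))

∑-mono : ∀ {n} {f g : Fin n → ℚ} → (∀ i → f i ≤ g i) → ∑ f ≤ ∑ g
∑-mono {zero} {f} {g} _ = ℚ.≤-reflexive (trans (∑-nil f) (sym (∑-nil g)))
∑-mono {suc n} {f} {g} h =
  subst₂ _≤_ (sym (∑-cons f)) (sym (∑-cons g)) (ℚ.+-mono-≤ (h zero) (∑-mono (h ∘ suc)))

members : ∀ {n} → Vec Bool n → List (Fin n)
members {n} S = filter (λ j → lookup S j Bool.≟ true) (allFin n)

length-members : ∀ {n} (S : Vec Bool n) → ℕ→ℚ (length (members S)) ≡ ∑ (λ j → if lookup S j then 1ℚ else 0ℚ)
length-members {n} S = go id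
  where
  go : ∀ {k} (f : Fin k → Fin n) → ℕ→ℚ (length (filter (λ j → lookup S j Bool.≟ true) (List.tabulate f)))
    ≡ ∑ (λ i → if lookup S (f i) then 1ℚ else 0ℚ)
  go {zero} f = sym (∑-nil (λ i → if lookup S (f i) then 1ℚ else 0ℚ))
  go {suc k} f with lookup S (f zero) | go (f ∘ suc) | ∑-cons (λ i → if lookup S (f i) then 1ℚ else 0ℚ)
  ... | true | ih | cons = trans (ℕ→ℚ-suc (length rest)) (trans (cong (1ℚ +_) ih) (sym cons))
    where rest = filter (λ j → lookup S j Bool.≟ true) (List.tabulate (f ∘ suc))
  ... | false | ih | cons = trans ih (trans (sym (ℚ.+-identityˡ _)) (sym cons))

lookup-ext : ∀ {A : Set} {n} {x y : Vec A n} → (∀ i → lookup x i ≡ lookup y i) → x ≡ y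
lookup-ext {x = x} {y} h = trans (sym (Vec.tabulate∘lookup x))
    (trans (Vec.tabulate-cong h) (Vec.tabulate∘lookup y))

lookup-lincomb : ∀ {n d} (l : Vec ℚ n) (ws : Vec (Vec ℚ d) n) i
  → lookup (lincomb l ws) i ≡ lookup l ∙ (λ j → lookup (lookup ws j) i)
lookup-lincomb [] [] i = trans (Vec.lookup-replicate i 0ℚ) (sym (∙-nil _ _))
lookup-lincomb (a ∷ l) (v ∷ ws) i = begin
  lookup (addV (scaleV a v) (lincomb l ws)) i
    ≡⟨ Vec.lookup-zipWith _+_ i (scaleV a v) (lincomb l ws) ⟩
  lookup (scaleV a v) i + lookup (lincomb l ws) i
    ≡⟨ cong₂ _+_ (Vec.lookup-map i (a *_) v) (lookup-lincomb l ws i) ⟩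
  a * lookup v i + lookup l ∙ (λ j → lookup (lookup ws j) i)
    ≡⟨ ∙-cons (lookup (a ∷ l)) (λ j → lookup (lookup (v ∷ ws) j) i) ⟨
  lookup (a ∷ l) ∙ (λ j → lookup (lookup (v ∷ ws) j) i) ∎
  where open ≡-Reasoning

sumQ≡∑ : ∀ {n} (l : Vec ℚ n) → sumQ l ≡ ∑ (lookup l)
sumQ≡∑ [] = sym (∑-nil (lookup []))
sumQ≡∑ (a ∷ l) = trans (cong (a +_) (sumQ≡∑ l)) (sym (∑-cons (lookup (a ∷ l))))

module _ {n D : ℕ} (vs : Vec (Vec ℤ D) (suc n)) where

  generator : Fin (suc n) → Fin (suc D) → ℚ
  generator j zero = 1ℚ
  generator j (suc i) = ℤ→ℚ (lookup (lookup vs j) i)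

  -- The height is rational so that negative dilation factors are covered as well.
  homogenise : ℚ → Vec ℤ D → Fin (suc D) → ℚ
  homogenise t x zero = t
  homogenise t x (suc i) = ℤ→ℚ (lookup x i)

  lookup-dilated : ∀ t (l : Vec ℚ (suc n)) i
    → lookup (lincomb l (Vec.map (λ v → scaleV t (toQ v)) vs)) i ≡ t * comb (lookup l) generator (suc i)
  lookup-dilated t l i = trans (lookup-lincomb l _ i)
    (trans (∙-congʳ (lookup l) (λ j → trans (cong (λ v → lookup v i) (Vec.lookup-map j _ vs))
        (trans (Vec.lookup-map i (t *_) (toQ (lookup vs j)))
          (cong (t *_) (Vec.lookup-map i ℤ→ℚ (lookup vs j))))))
      (∙-* (lookup l) (λ j → generator j (suc i)) t))

  inDilate⇒cone : ∀ {t x} → InDilate vs t x → Cone generator (homogenise (ℕ→ℚ t) x)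
  inDilate⇒cone {t} {x} (l , l≥0 , sum≡1 , eq) = (λ j → ℕ→ℚ t * lookup l j)
    , (λ j → 0≤* (ℕ→ℚ-nonNeg t) (lookup⁺ l≥0 j)) , rep
    where
    rep : ∀ i → homogenise (ℕ→ℚ t) x i ≡ comb (λ j → ℕ→ℚ t * lookup l j) generator i
    rep i = trans (scaled i) (sym (∙-*ˡ (lookup l) (λ j → generator j i) (ℕ→ℚ t)))
      where
      scaled : ∀ i → homogenise (ℕ→ℚ t) x i ≡ ℕ→ℚ t * comb (lookup l) generator i
      scaled zero = sym (trans (cong (ℕ→ℚ t *_) (trans (∙-one (lookup l)) (trans (sym (sumQ≡∑ l)) sum≡1)))
        (ℚ.*-identityʳ (ℕ→ℚ t)))
      scaled (suc i) = trans (sym (Vec.lookup-map i ℤ→ℚ x))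
        (trans (cong (λ v → lookup v i) (sym eq)) (lookup-dilated (ℕ→ℚ t) l i))

  -- The height coordinate says that the coefficients sum to the dilation factor; as this is
  -- positive, dividing by it gives convex weights.
  cone⇒inDilate : ∀ {t x} → Cone generator (homogenise (ℕ→ℚ (suc t)) x) → InDilate vs (suc t) x
  cone⇒inDilate {t} {x} (l , l≥0 , rep) = λs
    , tabulate⁺ (λ j → 0≤* (<⇒≤ r>0) (l≥0 j))
    , trans (sumQ≡∑ λs) (trans (∑-cong lookup-λs)
        (trans (∑-*ˡ r l) (trans (cong (r *_) (trans (sym (∙-one l)) (sym (rep zero)))) rT)))
    , lookup-ext λ i → trans (lookup-dilated T λs i)
        (trans (cong (T *_) (trans (∙-congˡ (λ j → generator j (suc i)) lookup-λs)
            (trans (∙-*ˡ l (λ j → generator j (suc i)) r) (cong (r *_) (sym (rep (suc i)))))))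
          (trans (trans (sym (ℚ.*-assoc T r _))
            (trans (cong (_* _) (trans (ℚ.*-comm T r) rT)) (ℚ.*-identityˡ _)))
            (sym (Vec.lookup-map i ℤ→ℚ x))))
    where
    T = ℕ→ℚ (suc t)
    T>0 : 0ℚ < T
    T>0 = subst (0ℚ <_) (sym (ℕ→ℚ-suc t)) (0<+ 0<1 (ℕ→ℚ-nonNeg t))
    inv = inverse T>0
    r = proj₁ inv
    r>0 = proj₁ (proj₂ inv)
    rT = proj₂ (proj₂ inv)
    λs : Vec ℚ (suc n)
    λs = tabulate (λ j → r * l j)
    lookup-λs : ∀ j → lookup λs j ≡ r * l j
    lookup-λs = Vec.lookup∘tabulate _

  -- Expand the part of z left after removing z₀ v₀ in the differences to v₀. This fixes all
  -- coordinates but the height, which is then corrected by changing the coefficient of v₀.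
  generator-spans : FullDim vs → ∀ (z : Fin (suc D) → ℚ)
    → Σ (Fin (suc n) → ℚ) λ γ → ∀ i → z i ≡ comb γ generator i
  generator-spans full z = spans vs refl full
    where
    spans : ∀ us → us ≡ vs → FullDim us → Σ (Fin (suc n) → ℚ) λ γ → ∀ i → z i ≡ comb γ generator i
    spans (v₀ ∷ us) refl full = (λ j → lookup μ j + h * δ zero j) , rep
      where
      z₀ = z zero
      y : Vec ℚ D
      y = tabulate (λ i → z (suc i) - z₀ * ℤ→ℚ (lookup v₀ i))
      μ = proj₁ (full y)
      s = ∑ (lookup μ)
      h = z₀ - s
      total : ∀ i → comb (λ j → lookup μ j + h * δ zero j) generator i
        ≡ comb (lookup μ) generator i + h * generator zero i
      total i = trans (∙-+ˡ (lookup μ) (λ j → h * δ zero j) (λ j → generator j i))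
        (cong (comb (lookup μ) generator i +_) (trans (∙-*ˡ (δ zero) (λ j → generator j i) h)
          (cong (h *_) (∙-δˡ zero (λ j → generator j i)))))
      rep : ∀ i → z i ≡ comb (λ j → lookup μ j + h * δ zero j) generator i
      rep zero = sym (trans (total zero) (trans (cong (λ p → p + h * 1ℚ) (∙-one (lookup μ)))
        (solve 2 (λ z s → s :+ (z :- s) :* con 1ℚ := z) refl z₀ s)))
      rep (suc i) = sym (trans (total (suc i)) (trans (cong (_+ h * g) combination)
        (solve 4 (λ z z₀ s g → (z :- z₀ :* g :+ s :* g) :+ (z₀ :- s) :* g := z) refl (z (suc i)) z₀ s g)))
        where
        g = ℤ→ℚ (lookup v₀ i)
        difference : z (suc i) - z₀ * g ≡ comb (lookup μ) generator (suc i) - s * g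
        difference = begin
          z (suc i) - z₀ * g
            ≡⟨ Vec.lookup∘tabulate (λ i → z (suc i) - z₀ * ℤ→ℚ (lookup v₀ i)) i ⟨
          lookup y i
            ≡⟨ cong (λ v → lookup v i) (proj₂ (full y)) ⟨
          lookup (lincomb μ (Vec.map (λ v → subV (toQ v) (toQ v₀)) vs)) i
            ≡⟨ lookup-lincomb μ _ i ⟩
          lookup μ ∙ (λ j → lookup (lookup (Vec.map (λ v → subV (toQ v) (toQ v₀)) vs) j) i)
            ≡⟨ ∙-congʳ (lookup μ) (λ j → trans (cong (λ v → lookup v i) (Vec.lookup-map j _ vs))
                 (trans (Vec.lookup-zipWith _-_ i (toQ (lookup vs j)) (toQ v₀))
                   (trans (cong₂ _-_ (Vec.lookup-map i ℤ→ℚ (lookup vs j)) (Vec.lookup-map i ℤ→ℚ v₀))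
                     (solve 2 (λ p g → p :- g := p :- g :* con 1ℚ) refl (generator j (suc i)) g)))) ⟩
          lookup μ ∙ (λ j → generator j (suc i) - g * 1ℚ)
            ≡⟨ ∙-shift (lookup μ) (λ j → generator j (suc i)) (λ _ → 1ℚ) g ⟩
          comb (lookup μ) generator (suc i) - g * (lookup μ ∙ (λ _ → 1ℚ))
            ≡⟨ cong (λ p → comb (lookup μ) generator (suc i) - p)
                (trans (cong (g *_) (∙-one (lookup μ))) (ℚ.*-comm g s)) ⟩
          comb (lookup μ) generator (suc i) - s * g ∎
          where open ≡-Reasoning
        combination : comb (lookup μ) generator (suc i) ≡ z (suc i) - z₀ * g + s * g
        combination = trans (solve 2 (λ p q → p := p :- q :+ q) refl _ (s * g))
            (cong (_+ s * g) (sym difference))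

generator-integral : ∀ {n D} (vs : Vec (Vec ℤ D) (suc n)) j → IntegralPoint (generator vs j)
generator-integral vs j zero = ℤ.+ 1 , refl
generator-integral vs j (suc i) = lookup (lookup vs j) i , refl

-- Entries of the h*-vector, summed over the cells.

module HStar {n D : ℕ} (vs : Vec (Vec ℤ D) (suc n)) (full : FullDim vs) where

  m : ℕ
  m = suc D

  w : Fin (suc n) → Fin m → ℚ
  w = generator vs

  open Triangulation w (generator-integral vs) (generator-spans vs full) (λ _ → refl)

  -- Index s stands for the dilation factor s − 2, so that the factors −2 and −1 are covered.
  point : ℕ → Vec ℤ D → Fin m → ℚ
  point s x = homogenise vs (ℕ→ℚ s + -2ℚ) x

  point-integral : ∀ s x → IntegralPoint (point s x)
  point-integral s x zero = integral-+ (ℤ.+ s , refl) (ℤ.-[1+ 1 ] , refl)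
  point-integral s x (suc i) = lookup x i , refl

  -- An m-th difference from index s ends at the factor s + D - 1, so for the full count these are
  -- the entries of the h*-vector at D - 1 and D + 1. Both conditions are additive and can be
  -- checked cell by cell.
  Good : (ℕ → ℚ) → Set
  Good f = 0ℚ ≤ Δ^ m f 0 × Δ^ m f 2 ≡ 0ℚ

  good? : ∀ f → Dec (Good f)
  good? f = (0ℚ ≤? Δ^ m f 0) ×-dec (Δ^ m f 2 ≟ 0ℚ)

  good-cong : ∀ {f g} → (∀ s → f s ≡ g s) → Good f → Good g
  good-cong h (p , q) = subst (0ℚ ≤_) (Δ^-cong m h 0) p , trans (sym (Δ^-cong m h 2)) q

  good-+ : ∀ {f g} → Good f → Good g → Good (λ s → f s + g s)
  good-+ {f} {g} (p , q) (p′ , q′) = subst (0ℚ ≤_) (sym (Δ^-+ m f g 0)) (0≤+ p p′)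
    , trans (Δ^-+ m f g 2) (trans (cong₂ _+_ q q′) (ℚ.+-identityˡ 0ℚ))

  good-zero : ∀ {f} → (∀ s → f s ≡ 0ℚ) → Good f
  good-zero h = ℚ.≤-reflexive (sym (Δ^-zero m h 0)) , Δ^-zero m h 2

  module _ (ys : ℕ → List (Vec ℤ D)) (ys-unique : ∀ (s : ℕ) → Unique (ys s))
    (sound : ∀ {s : ℕ} {x : Vec ℤ D} → x ∈ ys s → Cone w (point s x))
    (complete : ∀ {s : ℕ} {x : Vec ℤ D} → Cone w (point s x) → x ∈ ys s)
    where

    open Labelled Good good-cong (λ {f} {g} → good-+ {f} {g})

    label : ℕ → Vec ℤ D → Vec Bool (suc n)
    label s x = cell (point s x)

    class : Vec Bool (suc n) → ℕ → ℚ
    class S s = ℕ→ℚ (count (λ x → label s x ≟ᵛ S) (ys s))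

    module _ {S : Vec Bool (suc n)} (B : Basis w S) (opt : Optimal w S) where
      open Basis B

      js : List (Fin (suc n))
      js = members S

      ∈js⁻ : ∀ {j} → j ∈ js → lookup S j ≡ true
      ∈js⁻ j∈ = proj₂ (∈-filter⁻ (λ j → lookup S j Bool.≟ true) {xs = allFin _} j∈)

      ∈js⁺ : ∀ {j} → lookup S j ≡ true → j ∈ js
      ∈js⁺ {j} = ∈-filter⁺ (λ j → lookup S j Bool.≟ true) (∈-allFin j)

      |js|≡m : length js ≡ m
      |js|≡m = ℤ.+-injective (ℤ→ℚ-injective (trans (length-members S) (trans trace (∑-one m))))

      u : Fin (suc n) → ℕ → Vec ℤ D → ℚ
      u j s x = coord j ∙ shift (point s x)

      move move⁻ : Fin (suc n) → Vec ℤ D → Vec ℤ D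
      move j x = zipWith ℤ._+_ x (lookup vs j)
      move⁻ j x = zipWith ℤ._-_ x (lookup vs j)

      move-move⁻ : ∀ j x → move j (move⁻ j x) ≡ x
      move-move⁻ j x = lookup-ext λ i → trans (Vec.lookup-zipWith ℤ._+_ i (move⁻ j x) (lookup vs j))
        (trans (cong (ℤ._+ lookup (lookup vs j) i) (Vec.lookup-zipWith ℤ._-_ i x (lookup vs j)))
          (trans (ℤ.+-assoc (lookup x i) _ _) (trans (cong (λ z → lookup x i ℤ.+ z)
            (ℤ.+-inverseˡ (lookup (lookup vs j) i))) (ℤ.+-identityʳ (lookup x i)))))

      move⁻-move : ∀ j x → move⁻ j (move j x) ≡ x
      move⁻-move j x = lookup-ext λ i → trans (Vec.lookup-zipWith ℤ._-_ i (move j x) (lookup vs j))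
        (trans (cong (ℤ._- lookup (lookup vs j) i) (Vec.lookup-zipWith ℤ._+_ i x (lookup vs j)))
          (trans (ℤ.+-assoc (lookup x i) _ _) (trans (cong (λ z → lookup x i ℤ.+ z)
            (ℤ.+-inverseʳ (lookup (lookup vs j) i))) (ℤ.+-identityʳ (lookup x i)))))

      shift-move : ∀ j s x i → shift (point (suc s) (move j x)) i ≡ shift (point s x) i + w j i
      shift-move j s x zero = trans (cong (λ z → z + -2ℚ + ξ zero) (ℕ→ℚ-suc s))
        (solve 3 (λ t b e → con 1ℚ :+ t :+ b :+ e := t :+ b :+ e :+ con 1ℚ) refl (ℕ→ℚ s) -2ℚ (ξ zero))
      shift-move j s x (suc i) = trans
          (cong (λ z → ℤ→ℚ z + ξ (suc i)) (Vec.lookup-zipWith ℤ._+_ i x (lookup vs j)))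
        (trans (cong (_+ ξ (suc i)) (sym (/1-+ (lookup x i) (lookup (lookup vs j) i))))
          (solve 3 (λ p q e → p :+ q :+ e := p :+ e :+ q) refl
            (ℤ→ℚ (lookup x i)) (ℤ→ℚ (lookup (lookup vs j) i)) (ξ (suc i))))

      u-shift : ∀ {j} → j ∈ js → ∀ k s x → u k (suc s) (move j x) ≡ u k s x + δ j k
      u-shift {j} j∈ k s x = trans (∙-congʳ (coord k) (shift-move j s x))
        (trans (∙-+ (coord k) (shift (point s x)) (w j)) (cong (λ z → u k s x + z) (dual j (∈js⁻ j∈) k)))

      open BoxCount ys ys-unique u move move⁻ move-move⁻ move⁻-move js
        (Unique.filter⁺ (λ j → lookup S j Bool.≟ true) (Unique.allFin⁺ (suc n)))
        (λ {j} {s} {x} j∈ → trans (u-shift j∈ j s x) (cong (λ z → u j s x + z) (δ-refl j)))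
        (λ {j} {k} {s} {x} j∈ _ j≢k → trans (u-shift j∈ k s x)
          (trans (cong (λ z → u k s x + z) (δ-≢ j≢k)) (ℚ.+-identityʳ (u k s x))))

      pos⇒cell : ∀ {s x} → Pos s x → Cone w (point s x) × label s x ≡ S
      pos⇒cell {s} {x} pos = inCell⇒cell B opt (point-integral s x) (λ j j∈ → pos (∈js⁺ j∈))

      boxCount : ℕ → ℕ
      boxCount s = count (Bounded? (js ʳ++ []) s) (ys s)

      Δ^-box : ∀ s → Δ^ (length js) (λ s → ℕ→ℚ (count (Pos? s) (ys s))) s ≡ ℕ→ℚ (boxCount (length js ℕ.+ s))
      Δ^-box = Δ^-positive (λ {s} {x} pos → complete {s} {x} (proj₁ (pos⇒cell {s} {x} pos)))

      class-count : ∀ s → ℕ→ℚ (count (Pos? s) (ys s)) ≡ class S s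
      class-count s = cong ℕ→ℚ (count-cong (Pos? s) (λ x → label s x ≟ᵛ S) (ys s)
        (λ {x} _ pos → proj₂ (pos⇒cell {s} {x} pos))
        (λ {x} x∈ eq {j} j∈ → cell⇒inCell B (sound {s} {x} x∈) eq j (∈js⁻ j∈)))

      -- The coordinates of a point sum to its height, which is at least D + 1 + ξ₀ here.
      no-box : ∀ {x} → ¬ Bounded (js ʳ++ []) (length js ℕ.+ 2) x
      no-box {x} (_ , bound) = <-irrefl refl (<-≤-trans m<height height≤m)
        where
        s = length js ℕ.+ 2
        X = shift (point s x)
        u≤1 : ∀ j → coord j ∙ X ≤ (if lookup S j then 1ℚ else 0ℚ)
        u≤1 j = bit (lookup S j) refl
          where
          bit : ∀ b → lookup S j ≡ b → coord j ∙ X ≤ (if b then 1ℚ else 0ℚ)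
          bit true eq = All.lookup bound (reverseAcc⁺ [] js (inj₂ (∈js⁺ eq)))
          bit false eq = ℚ.≤-reflexive (coord∙-off j eq X)
        height≤m : X zero ≤ ℕ→ℚ m
        height≤m = subst₂ _≤_ (sym (trans (expand X zero) (∙-one (λ j → coord j ∙ X))))
          (trans trace (∑-one m)) (∑-mono u≤1)
        m<height : ℕ→ℚ m < X zero
        m<height = 0<-⇒< (subst (0ℚ <_) (sym (begin
          ℕ→ℚ s + -2ℚ + ξ zero - ℕ→ℚ m
            ≡⟨ cong (λ k → ℕ→ℚ (k ℕ.+ 2) + -2ℚ + ξ zero - ℕ→ℚ m) |js|≡m ⟩
          ℕ→ℚ (m ℕ.+ 2) + -2ℚ + ξ zero - ℕ→ℚ m
            ≡⟨ cong (λ z → z + -2ℚ + ξ zero - ℕ→ℚ m) (/1-+ (ℤ.+ m) (ℤ.+ 2)) ⟨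
          ℕ→ℚ m + (1ℚ + 1ℚ) + -2ℚ + ξ zero - ℕ→ℚ m
            ≡⟨ solve 2 (λ k e → k :+ (con 1ℚ :+ con 1ℚ) :+ (:- (con 1ℚ :+ con 1ℚ)) :+ e :- k := e) refl
                 (ℕ→ℚ m) (ξ zero) ⟩
          ξ zero ∎)) ξ-height>0)
          where open ≡-Reasoning

      good-class : Good (class S)
      good-class = good-cong class-count
        ( subst (λ k → 0ℚ ≤ Δ^ k (λ s → ℕ→ℚ (count (Pos? s) (ys s))) 0) |js|≡m
            (subst (0ℚ ≤_) (sym (Δ^-box 0)) (ℕ→ℚ-nonNeg (boxCount (length js ℕ.+ 0))))
        , subst (λ k → Δ^ k (λ s → ℕ→ℚ (count (Pos? s) (ys s))) 2 ≡ 0ℚ) |js|≡m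
            (trans (Δ^-box 2) (cong (λ xs → ℕ→ℚ (length xs))
              (filter-none (Bounded? (js ʳ++ []) (length js ℕ.+ 2))
                (All.tabulate {xs = ys (length js ℕ.+ 2)} λ _ → no-box)))))

    -- Whether some point carries the label S is not decided. `Good` is decidable, so suppose it
    -- fails: any point labelled S would make S an optimal basis and the class good, hence the class
    -- is empty at every index, which is good too.
    good-classes : ∀ S → Good (class S)
    good-classes S = decidable-stable (good? (class S)) λ bad → bad (good-zero (λ s →
      cong (λ xs → ℕ→ℚ (length xs)) (filter-none (λ x → label s x ≟ᵛ S)
        (All.tabulate λ {x} x∈ eq → bad (hit s x x∈ eq)))))
      where
      hit : ∀ s x → x ∈ ys s → label s x ≡ S → Good (class S)
      hit s x x∈ refl = good-class (cell-basis (point-integral s x) (sound {s} {x} x∈))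
          (proj₁ (cell-optimal (sound {s} {x} x∈)))

    good-count : Good (λ s → ℕ→ℚ (length (ys s)))
    good-count = sum-over-labels label ys good-classes

-- The counting function and the Ehrhart polynomial.

±1-cancel : ∀ n {p} → ±1 n * p ≡ 0ℚ → p ≡ 0ℚ
±1-cancel zero {p} h = trans (sym (ℚ.*-identityˡ p)) h
±1-cancel (suc n) {p} h = ±1-cancel n (trans
  (solve 2 (λ e p → e :* p := :- ((:- e) :* p)) refl (±1 n) p) (cong -_ h))

module Counting {n D : ℕ} (vs : Vec (Vec ℤ D) (suc n)) (L : Vec ℚ (suc D))
    (ehrhart : IsEhrhartPoly vs L) where

  -- The lattice points of the cone over P at height s - 2: none below height 0, the origin alone at
  -- 0, and the lists of the hypothesis from height 1 on.
  latticePoints : ℕ → List (Vec ℤ D)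
  latticePoints 0 = []
  latticePoints 1 = []
  latticePoints 2 = replicate D (ℤ.+ 0) ∷ []
  latticePoints (suc (suc (suc t))) = proj₁ (ehrhart (suc t) (ℕ.s≤s ℕ.z≤n))

  dilate : ℕ → Vec ℤ D → Fin (suc D) → ℚ
  dilate s x = homogenise vs (ℕ→ℚ s + -2ℚ) x

  latticePoints-unique : ∀ s → Unique (latticePoints s)
  latticePoints-unique 0 = []
  latticePoints-unique 1 = []
  latticePoints-unique 2 = [] ∷ []
  latticePoints-unique (suc (suc (suc t))) = proj₁ (proj₂ (ehrhart (suc t) (ℕ.s≤s ℕ.z≤n)))

  factor : ∀ t → ℕ→ℚ (suc (suc (suc t))) + -2ℚ ≡ ℕ→ℚ (suc t)
  factor t = trans (cong (_+ -2ℚ) (trans (ℕ→ℚ-suc (suc (suc t))) (cong (1ℚ +_) (ℕ→ℚ-suc (suc t)))))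
    (solve 1 (λ p → con 1ℚ :+ (con 1ℚ :+ p) :+ (:- (con 1ℚ :+ con 1ℚ)) := p) refl (ℕ→ℚ (suc t)))

  zero-cone : Cone (generator vs) (dilate 2 (replicate D (ℤ.+ 0)))
  zero-cone = (λ _ → 0ℚ) , (λ _ → ≤-refl) , λ i → trans (coordinate i)
      (sym (∙-zeroˡ (λ j → generator vs j i) (λ _ → refl)))
    where
    coordinate : ∀ i → dilate 2 (replicate D (ℤ.+ 0)) i ≡ 0ℚ
    coordinate zero = refl
    coordinate (suc i) = cong ℤ→ℚ (Vec.lookup-replicate i (ℤ.+ 0))

  -- At height 0 the nonnegative coefficients sum to 0, so all of them vanish.
  zero-cone-unique : ∀ {x} → Cone (generator vs) (dilate 2 x) → x ≡ replicate D (ℤ.+ 0)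
  zero-cone-unique {x} (l , l≥0 , rep) = lookup-ext λ i → trans
      (ℤ→ℚ-injective {lookup x i} {ℤ.+ 0}
        (trans (rep (suc i)) (∙-zeroˡ (λ j → generator vs j (suc i)) l≡0)))
      (sym (Vec.lookup-replicate i (ℤ.+ 0)))
    where
    l≡0 : ∀ j → l j ≡ 0ℚ
    l≡0 = ∑≡0⇒≡0 l≥0 (trans (sym (∙-one l)) (sym (rep zero)))

  latticePoints-sound : ∀ {s x} → x ∈ latticePoints s → Cone (generator vs) (dilate s x)
  latticePoints-sound {2} (here refl) = zero-cone
  latticePoints-sound {suc (suc (suc t))} {x} x∈ = subst (λ h → Cone (generator vs) (homogenise vs h x))
      (sym (factor t))
    (inDilate⇒cone vs {suc t} (Equivalence.to (proj₁ (proj₂ (proj₂ (ehrhart (suc t) (ℕ.s≤s ℕ.z≤n)))) x) x∈))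

  latticePoints-complete : ∀ {s x} → Cone (generator vs) (dilate s x) → x ∈ latticePoints s
  -- Heights -2 and -1 lie below the cone.
  latticePoints-complete {0} c with cone-height (λ _ → refl) c
  ... | ℚ.*≤* ()
  latticePoints-complete {1} c with cone-height (λ _ → refl) c
  ... | ℚ.*≤* ()
  latticePoints-complete {2} c = here (zero-cone-unique c)
  latticePoints-complete {suc (suc (suc t))} {x} c =
    Equivalence.from (proj₁ (proj₂ (proj₂ (ehrhart (suc t) (ℕ.s≤s ℕ.z≤n)))) x)
      (cone⇒inDilate vs {t} (subst (λ h → Cone (generator vs) (homogenise vs h x)) (factor t) c))

  number : ℕ → ℚ
  number s = ℕ→ℚ (length (latticePoints s))

  -- It vanishes at all positive factors, and its (D+1)-st differences are those of the count
  -- because L has degree at most D.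
  error : ℕ → ℚ
  error s = number s - evalPoly L (ℕ→ℚ s + -2ℚ)

  Δ^-error : ∀ s → Δ^ (suc D) error s ≡ Δ^ (suc D) number s
  Δ^-error s = trans (Δ^-− (suc D) number (λ s → evalPoly L (ℕ→ℚ s + -2ℚ)) s)
    (trans (cong (λ z → Δ^ (suc D) number s - z) (Δ^-poly L -2ℚ s)) (ℚ.+-identityʳ _))

  error-vanishes : ∀ t → error (suc (suc (suc t))) ≡ 0ℚ
  error-vanishes t = trans
    (cong₂ _-_ (proj₂ (proj₂ (proj₂ (ehrhart (suc t) (ℕ.s≤s ℕ.z≤n))))) (cong (evalPoly L) (factor t)))
    (ℚ.+-inverseʳ (evalPoly L (ℕ→ℚ (suc t))))

  module _ (vanish : Δ^ (suc D) number 2 ≡ 0ℚ) where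

    -- L(0) = 1, read off from the value of the difference operator at the dilation factor 0.
    error₂ : error 2 ≡ 0ℚ
    error₂ = ±1-cancel (suc D) (begin
      ±1 (suc D) * error 2
        ≡⟨ solve 3 (λ e p n → e :* p := e :* (p :- n :* con 0ℚ)) refl (±1 (suc D)) (error 2) (ℕ→ℚ (suc D)) ⟩
      ±1 (suc D) * (error 2 - ℕ→ℚ (suc D) * 0ℚ)
        ≡⟨ cong (λ z → ±1 (suc D) * (error 2 - ℕ→ℚ (suc D) * z)) (error-vanishes 0) ⟨
      ±1 (suc D) * (error 2 - ℕ→ℚ (suc D) * error 3)
        ≡⟨ Δ^-two-terms (suc D) {error} 2
            (λ k → trans (cong (λ z → error (suc (suc z))) (ℕ.+-comm k 2)) (error-vanishes (suc k))) ⟨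
      Δ^ (suc D) error 2
        ≡⟨ trans (Δ^-error 2) vanish ⟩
      0ℚ ∎)
      where open ≡-Reasoning

    -- At the factors -2 and -1 nothing is counted, so the error there is -L; from factor 0 on it is
    -- 0. The two remaining terms of the difference give the right-hand side, the minus sign turning
    -- the sign of D + 1 into that of D.
    reciprocity : Δ^ (suc D) number 0 ≡ ±1 D * (evalPoly L -2ℚ - ℕ→ℚ (suc D) * evalPoly L -1ℚ)
    reciprocity = begin
      Δ^ (suc D) number 0
        ≡⟨ Δ^-error 0 ⟨
      Δ^ (suc D) error 0
        ≡⟨ Δ^-two-terms (suc D) {error} 0
            (λ k → trans (cong (λ z → error (suc (suc z))) (ℕ.+-identityʳ k)) (later k)) ⟩
      ±1 (suc D) * (error 0 - ℕ→ℚ (suc D) * error 1)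
        ≡⟨ solve 4 (λ e n p q → (:- e) :* ((con 0ℚ :- p) :- n :* (con 0ℚ :- q)) := e :* (p :- n :* q)) refl
             (±1 D) (ℕ→ℚ (suc D)) (evalPoly L -2ℚ) (evalPoly L -1ℚ) ⟩
      ±1 D * (evalPoly L -2ℚ - ℕ→ℚ (suc D) * evalPoly L -1ℚ) ∎
      where
      open ≡-Reasoning
      later : ∀ k → error (suc (suc k)) ≡ 0ℚ
      later zero = error₂
      later (suc k) = error-vanishes k

theorem2 : (d : ℕ) → (n : ℕ) → (vs : Vec (Vec ℤ (suc d)) (suc n))
    → FullDim vs → (L : Vec ℚ (suc (suc d))) → IsEhrhartPoly vs L
    → 0ℚ ≤ weightedSum (suc d) L
theorem2 d n vs full L ehrhart = subst (0ℚ ≤_)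
    (trans (reciprocity (proj₂ good)) (sym (weightedSum-eval d L))) (proj₁ good)
  where
  open Counting vs L ehrhart
  open HStar vs full
  good : Good number
  good = good-count latticePoints latticePoints-unique
    (λ {s} {x} → latticePoints-sound {s} {x}) (λ {s} {x} → latticePoints-complete {s} {x})
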